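{- Let $G_1$ and $G_2$ be internally $4$-connected graphs such that $|E(G_1)|\le15$ and $G_1$ has a proper $G_2$-minor. Assume also that whenever $G$ is an internally $4$-connected graph such that $G_1$ has a proper $G$-minor and $G$ has a $G_2$-minor, then $|E(G_1)|-|E(G)|>3$. Then, up to isomorphism, one of the following holds: (i) $G_1$ is one of $K_5$, $Q_3$, $O$, $\mathrm{QML}_7$, and $G_2$ is $K_4$; (ii) $G_1$ is one of $H_1,H_2,H_3,\mathrm{QML}_7$, and $G_2$ is $K_{3,3}$; (iii) $G_1$ is one of $Q_3^{\times}$, $Y_9$, $\mathrm{QML}_7$, $\mathrm{CML}_{10}$, and $G_2$ is $K_5$.
   Context: Let $G$ be a simple $3$-connected graph. For a partition $(X,Y)$ of $E(G)$, let $V(X,Y)$ be the set of vertices incident with edges of both $X$ and $Y$. $G$ is internally $4$-connected if, whenever $3\le|X|\le|Y|$, we have $|V(X,Y)|\ge3$, and equality implies that $X$ is a triangle or the set of edges incident with a vertex of degree $3$. $Q_3$ is the cube graph and $O$ the octahedron graph. $\mathrm{QML}_7$ has vertex set $\mathbb{Z}_7$ with $i$ adjacent to $i\pm1$ and $i\pm3$. $\mathrm{CML}_{10}$ has vertex set $\mathbb{Z}_{10}$ with $i$ adjacent to $i\pm1$ and $i+5$. $H_1$ has vertices $0,\dots,5$ and edges $01,02,04,05,12,13,14,15,23,24,34,35,45$. $H_2$ has vertices $0,\dots,6$ and edges $01,03,05,12,14,16,23,25,26,34,36,45,46$. $H_3$ has vertices $0,\dots,7$ and edges $01,03,07,12,16,23,25,27,34,45,47,56,67$.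 $Q_3^{\times}$ has vertices $0,\dots,7$ and edges $01,05,07,12,14,23,26,27,34,36,37,45,56,67$. $Y_9$ has vertices $0,\dots,8$ and edges $01,03,05,07,12,18,23,26,34,45,48,56,67,78$. -}

module Defs where

open import Data.Nat using (ℕ; zero; suc; _+_; _≤_; _<_; _<ᵇ_; _≡ᵇ_; _%_)
open import Data.Fin using (Fin; toℕ)
open import Data.Fin.Properties using (_≟_)
open import Data.Bool using (Bool; true; false; _∧_; _∨_; not; if_then_else_)
open import Data.List using (List; []; _∷_; length; map; concatMap; filterᵇ; allFin)
open import Data.Bool.ListAction using (any)
open import Data.List.Relation.Unary.All using (All)
open import Data.Maybe using (Maybe; just; nothing)
open import Data.Product using (Σ; ∃; _×_; _,_; proj₁; proj₂; uncurry)
open import Data.Sum using (_⊎_)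
open import Relation.Nullary using (¬_)
open import Relation.Binary.PropositionalEquality using (_≡_)

-- Finite simple graphs on vertex set Fin n.
-- The edge relation is only consulted on pairs i < j, and adjacency is
-- derived from it, so graphs are simple (loopless, undirected, no
-- parallel edges) by construction.

record Graph : Set where
  constructor mkGraph
  field
    n  : ℕ
    E  : Fin n → Fin n → Bool

open Graph public

adj : (G : Graph) → Fin (n G) → Fin (n G) → Bool
adj G i j =
  if toℕ i <ᵇ toℕ j then E G i j
  else (if toℕ j <ᵇ toℕ i then E G j i else false)

pairs : (m : ℕ) → List (Fin m × Fin m)
pairs m = filterᵇ (λ p → toℕ (proj₁ p) <ᵇ toℕ (proj₂ p))
                  (concatMap (λ i → map (λ j → (i , j)) (allFin m)) (allFin m))

edges : (G : Graph) → List (Fin (n G) × Fin (n G))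
edges G = filterᵇ (uncurry (adj G)) (pairs (n G))

∣E∣ : Graph → ℕ
∣E∣ G = length (edges G)

degree : (G : Graph) → Fin (n G) → ℕ
degree G v = length (filterᵇ (adj G v) (allFin (n G)))

_==_ : {m : ℕ} → Fin m → Fin m → Bool
i == j = toℕ i ≡ᵇ toℕ j

incident : {m : ℕ} → Fin m → Fin m × Fin m → Bool
incident v (i , j) = (v == i) ∨ (v == j)

data Walk (G : Graph) (P : Fin (n G) → Set) : Fin (n G) → Fin (n G) → Set where
  []  : ∀ {x} → P x → Walk G P x x
  _∷_ : ∀ {x y z} → (P x × adj G x y ≡ true) → Walk G P y z → Walk G P x z

ConnectedOn : (G : Graph) → (Fin (n G) → Set) → Set
ConnectedOn G P = ∀ x y → P x → P y → Walk G P x y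

-- 3-connected: at least 4 vertices, and deleting any set of at most two
-- vertices ({a , b}, possibly a = b) leaves a connected graph.
ThreeConnected : Graph → Set
ThreeConnected G =
  4 ≤ n G × (∀ (a b : Fin (n G)) → ConnectedOn G (λ v → ¬ v ≡ a × ¬ v ≡ b))

-- Internal 4-connectivity.
-- An edge partition (X , Y) of E(G) is given by a Boolean function X on
-- vertex pairs: an edge (i , j) (i < j) lies in X iff X i j ≡ true,
-- otherwise it lies in Y.

EdgeSet : Graph → Set
EdgeSet G = Fin (n G) → Fin (n G) → Bool

∣X∣ : (G : Graph) → EdgeSet G → ℕ
∣X∣ G X = length (filterᵇ (uncurry X) (edges G))

∣Y∣ : (G : Graph) → EdgeSet G → ℕ
∣Y∣ G X = length (filterᵇ (λ e → not (uncurry X e)) (edges G))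

inVXY : (G : Graph) → EdgeSet G → Fin (n G) → Bool
inVXY G X v =
  any (λ e → uncurry X e ∧ incident v e) (edges G) ∧
  any (λ e → not (uncurry X e) ∧ incident v e) (edges G)

∣VXY∣ : (G : Graph) → EdgeSet G → ℕ
∣VXY∣ G X = length (filterᵇ (inVXY G X) (allFin (n G)))

IsTriangle : (G : Graph) → EdgeSet G → Set
IsTriangle G X =
  Σ (Fin (n G)) λ a → Σ (Fin (n G)) λ b → Σ (Fin (n G)) λ c →
    adj G a b ≡ true × adj G b c ≡ true × adj G a c ≡ true ×
    All (λ e → uncurry X e ≡
           ((incident a e ∧ incident b e) ∨ (incident b e ∧ incident c e))
           ∨ (incident a e ∧ incident c e))
        (edges G)

IsDegree3Star : (G : Graph) → EdgeSet G → Set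
IsDegree3Star G X =
  Σ (Fin (n G)) λ v → degree G v ≡ 3 ×
    All (λ e → uncurry X e ≡ incident v e) (edges G)

Internally4Connected : Graph → Set
Internally4Connected G =
  ThreeConnected G ×
  (∀ (X : EdgeSet G) → 3 ≤ ∣X∣ G X → ∣X∣ G X ≤ ∣Y∣ G X →
     3 ≤ ∣VXY∣ G X ×
     (∣VXY∣ G X ≡ 3 → IsTriangle G X ⊎ IsDegree3Star G X))

record _≅_ (G H : Graph) : Set where
  field
    to      : Fin (n G) → Fin (n H)
    from    : Fin (n H) → Fin (n G)
    from∘to : ∀ x → from (to x) ≡ x
    to∘from : ∀ y → to (from y) ≡ y
    adj-pres : ∀ x y → adj H (to x) (to y) ≡ adj G x y

-- G has an H-minor: a family of pairwise disjoint, nonempty, connected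
-- branch sets in G, one for each vertex of H (φ x ≡ just u means x lies in
-- the branch set of u), such that adjacent vertices of H have branch sets
-- joined by an edge of G.
HasMinor : (G H : Graph) → Set
HasMinor G H =
  Σ (Fin (n G) → Maybe (Fin (n H))) λ φ →
    (∀ u → Σ (Fin (n G)) λ x → φ x ≡ just u) ×
    (∀ u → ConnectedOn G (λ x → φ x ≡ just u)) ×
    (∀ u v → adj H u v ≡ true →
       Σ (Fin (n G)) λ x → Σ (Fin (n G)) λ y →
         φ x ≡ just u × φ y ≡ just v × adj G x y ≡ true)

HasProperMinor : (G H : Graph) → Set
HasProperMinor G H = HasMinor G H × ¬ (H ≅ G)

fromList : (m : ℕ) → List (ℕ × ℕ) → Graph
fromList m l = mkGraph m (λ i j →
  any (λ p → ((toℕ i ≡ᵇ proj₁ p) ∧ (toℕ j ≡ᵇ proj₂ p)) ∨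
             ((toℕ i ≡ᵇ proj₂ p) ∧ (toℕ j ≡ᵇ proj₁ p))) l)

K : ℕ → Graph
K m = mkGraph m (λ _ _ → true)

K₄ K₅ : Graph
K₄ = K 4
K₅ = K 5

K₃₃ : Graph
K₃₃ = mkGraph 6 (λ i j → (toℕ i <ᵇ 3) ∧ not (toℕ j <ᵇ 3))

-- cube: vertices 0..7 as 3-bit strings, adjacent iff they differ in one bit
Q₃ : Graph
Q₃ = fromList 8
  ((0 , 1) ∷ (0 , 2) ∷ (0 , 4) ∷ (1 , 3) ∷ (1 , 5) ∷ (2 , 3) ∷
   (2 , 6) ∷ (3 , 7) ∷ (4 , 5) ∷ (4 , 6) ∷ (5 , 7) ∷ (6 , 7) ∷ [])

-- octahedron: K₆ minus the perfect matching {05, 14, 23}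
O : Graph
O = mkGraph 6 (λ i j → not ((toℕ i + toℕ j) ≡ᵇ 5))

-- circulant on ℤ_m: i < j adjacent iff (j - i) mod m is in the list ds
circulant : (m : ℕ) → List ℕ → Graph
circulant m ds = mkGraph m (λ i j →
  any (λ d → ((toℕ j + (m Data.Nat.∸ toℕ i)) % suc (m Data.Nat.∸ 1)) ≡ᵇ d) ds)

QML₇ : Graph
QML₇ = circulant 7 (1 ∷ 6 ∷ 3 ∷ 4 ∷ [])

CML₁₀ : Graph
CML₁₀ = circulant 10 (1 ∷ 9 ∷ 5 ∷ [])

H₁ : Graph
H₁ = fromList 6
  ((0 , 1) ∷ (0 , 2) ∷ (0 , 4) ∷ (0 , 5) ∷ (1 , 2) ∷ (1 , 3) ∷ (1 , 4) ∷
   (1 , 5) ∷ (2 , 3) ∷ (2 , 4) ∷ (3 , 4) ∷ (3 , 5) ∷ (4 , 5) ∷ [])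

H₂ : Graph
H₂ = fromList 7
  ((0 , 1) ∷ (0 , 3) ∷ (0 , 5) ∷ (1 , 2) ∷ (1 , 4) ∷ (1 , 6) ∷ (2 , 3) ∷
   (2 , 5) ∷ (2 , 6) ∷ (3 , 4) ∷ (3 , 6) ∷ (4 , 5) ∷ (4 , 6) ∷ [])

H₃ : Graph
H₃ = fromList 8
  ((0 , 1) ∷ (0 , 3) ∷ (0 , 7) ∷ (1 , 2) ∷ (1 , 6) ∷ (2 , 3) ∷ (2 , 5) ∷
   (2 , 7) ∷ (3 , 4) ∷ (4 , 5) ∷ (4 , 7) ∷ (5 , 6) ∷ (6 , 7) ∷ [])

Q₃× : Graph
Q₃× = fromList 8
  ((0 , 1) ∷ (0 , 5) ∷ (0 , 7) ∷ (1 , 2) ∷ (1 , 4) ∷ (2 , 3) ∷ (2 , 6) ∷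
   (2 , 7) ∷ (3 , 4) ∷ (3 , 6) ∷ (3 , 7) ∷ (4 , 5) ∷ (5 , 6) ∷ (6 , 7) ∷ [])

Y₉ : Graph
Y₉ = fromList 9
  ((0 , 1) ∷ (0 , 3) ∷ (0 , 5) ∷ (0 , 7) ∷ (1 , 2) ∷ (1 , 8) ∷ (2 , 3) ∷
   (2 , 6) ∷ (3 , 4) ∷ (4 , 5) ∷ (4 , 8) ∷ (5 , 6) ∷ (6 , 7) ∷ (7 , 8) ∷ [])

{-# OPTIONS --safe #-}

-- Internal 4-connectivity with at most 15 edges forces minimum degree 3, at most 10 vertices, and, once there
-- are 8 edges, that no vertex of degree 3 lies in a triangle. To enumerate the graphs with these properties,
-- process the vertices one at a time, keeping the unprocessed ones partitioned into cells of vertices with the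
-- same degree and the same adjacencies to processed vertices. The next vertex may be any element of the first
-- cell, and only the number of its neighbours in each cell matters, so that few cases remain: up to isomorphism,
-- 39 internally 4-connected graphs. The gap hypothesis applied to G₂ itself leaves K₄, K₃₃ and K₅ for G₂. For every graph R in the list
-- and each of these S, either the pair is in the conclusion, or some internally 4-connected G lies between R and S
-- and is too close to R, or R has no S-minor; the last case concerns only the pentagonal bipyramid and the
-- pentagonal prism.
module Submission where

open import Defs
open import Data.Nat.Properties hiding (_≟_)
open import Algebra.Properties.CommutativeSemigroup +-commutativeSemigroup using (interchange)
open import Data.Bool using (Bool; true; false; _∧_; _∨_; not; if_then_else_; T; T?)
open import Data.Bool.ListAction using (any; all; or)
open import Data.Bool.Properties using (∧-identityʳ; ∧-comm; ∨-comm; ∨-zeroʳ; not-involutive)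
open import Data.Empty using (⊥; ⊥-elim)
open import Data.Fin using (Fin; toℕ; zero; suc)
open import Data.Fin.Properties using (_≟_; ¬∀⟶∃¬; toℕ-injective)
open import Data.List
  using (List; []; _∷_; _++_; map; concatMap; concat; length; filterᵇ; allFin; upTo; reverse)
open import Data.List.Membership.Propositional using (_∈_)
open import Data.List.Membership.Propositional.Properties
open import Data.List.Membership.Propositional.Properties.WithK using (unique∧set⇒bag)
open import Data.List.Properties
  using (map-∘; map-cong; length-tabulate; length-map; ++-identityʳ; filter-++; ++-assoc)
open import Data.List.Relation.Binary.BagAndSetEquality using (∼bag⇒↭)
open import Data.List.Relation.Binary.Permutation.Propositional
  using (_↭_; ↭-refl; ↭-sym; ↭-trans; prep; ↭-reflexive; ↭⇒↭ₛ; module PermutationReasoning)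
open import Data.List.Relation.Binary.Permutation.Propositional.Properties
  using (map⁺; ++⁺ˡ; shift; ++⁺; ∈-resp-↭; ↭-length)
open import Data.List.Relation.Binary.Pointwise using (Pointwise; []; _∷_)
open import Data.List.Relation.Unary.All as All using (All; []; _∷_)
import Data.List.Relation.Unary.All.Properties as All
open import Data.List.Relation.Unary.AllPairs using ([]; _∷_)
open import Data.List.Relation.Unary.Any as Any using (here; there)
open import Data.List.Relation.Unary.Any.Properties using (reverse⁺)
open import Data.List.Relation.Unary.Unique.Propositional using (Unique)
import Data.List.Relation.Unary.Unique.Propositional.Properties as Unique
open import Data.Maybe as Maybe using (Maybe; just; nothing; is-nothing)
open import Data.Maybe.Properties using (just-injective)
open import Data.Nat
  using (ℕ; zero; suc; _+_; _*_; _∸_; _/_; _%_; _≤_; _<_; _<ᵇ_; _≤ᵇ_; _≡ᵇ_; z≤n; s≤s)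
open import Data.Nat.ListAction using (sum)
open import Data.Nat.ListAction.Properties using (sum-↭)
open import Data.Product using (Σ; _×_; _,_; proj₁; proj₂; uncurry; swap)
open import Data.Sum using (_⊎_; inj₁; inj₂)
open import Data.Unit using (tt)
open import Data.Vec as Vec using (Vec; lookup)
open import Data.Vec.Properties using (lookup-map; lookup-allFin)
open import Function using (_∘_; id; case_of_)
open import Function.Bundles using (mk⇔)
open import Relation.Binary.PropositionalEquality
open import Relation.Nullary using (¬_; contradiction; yes; no)
open import Relation.Nullary.Decidable using (_⊎-dec_)

-- Internal 4-connectivity is used in two ways. To bound the list, a necessary condition is enough,
-- and `Robust` is made for this: it is invariant under isomorphism, triangles and stars no longer
-- occur in it, and a single edge set refutes it. The full definition is verified only for the eight
-- graphs that serve as intermediate G. The obstacle is that edges are listed as pairs i < j, an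
-- order that an isomorphism may reverse. Edge counts are therefore doubled into sums over all pairs
-- of vertices, and the edge sets in `Robust` are symmetric. The bounds come from counting: minimum
-- degree 3 gives 3|V| ≤ 2|E| ≤ 30, and |E(G₂)| + 3 < |E(G₁)| ≤ 15 leaves at most 11 edges to G₂.
-- Finite claims are Boolean tests with soundness lemmas, applied to explicit isomorphisms,
-- separations and branch sets that are written as numerals. The absence of a minor has no such
-- short witness; there, a search through all contractions is evaluated.

private variable
  A B : Set

-- Booleans, finite sums and counting in lists

∧-true : ∀ {a b} → a ∧ b ≡ true → a ≡ true × b ≡ true
∧-true {true} {true} _ = refl , refl

∧-intro : ∀ {a b} → a ≡ true → b ≡ true → a ∧ b ≡ true
∧-intro refl refl = refl

not-true : ∀ {a} → not a ≡ true → a ≡ false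
not-true {false} _ = refl

true≢false : ∀ {b} → b ≡ true → b ≡ false → ⊥
true≢false refl ()

bool-ext : ∀ {a b} → (a ≡ true → b ≡ true) → (b ≡ true → a ≡ true) → a ≡ b
bool-ext {true}  {true}  f g = refl
bool-ext {true}  {false} f g = sym (f refl)
bool-ext {false} {true}  f g = g refl
bool-ext {false} {false} f g = refl

any-true : (p : A → Bool) {xs : List A} {x : A} → x ∈ xs → p x ≡ true → any p xs ≡ true
any-true p {y ∷ xs} (here refl) e rewrite e = refl
any-true p {y ∷ xs} (there x∈) e with p y
... | true  = refl
... | false = any-true p x∈ e

any-witness : (p : A → Bool) (xs : List A) → any p xs ≡ true → Σ A λ x → x ∈ xs × p x ≡ true
any-witness p (x ∷ xs) e with p x in px
... | true = x , here refl , px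
... | false = let y , y∈ , py = any-witness p xs e in y , there y∈ , py

all-lookup : (p : A → Bool) {xs : List A} {x : A} → all p xs ≡ true → x ∈ xs → p x ≡ true
all-lookup p e (here refl) = proj₁ (∧-true e)
all-lookup p {y ∷ xs} e (there x∈) = all-lookup p (proj₂ (∧-true {p y} e)) x∈

all-allFin : ∀ {n} (p : Fin n → Bool) → all p (allFin n) ≡ true → ∀ i → p i ≡ true
all-allFin p e i = all-lookup p e (∈-allFin i)

any-allFin : ∀ {n} (p : Fin n → Bool) i → p i ≡ true → any p (allFin n) ≡ true
any-allFin p i = any-true p (∈-allFin i)

==⇒≡ : ∀ {n} (i j : Fin n) → (i == j) ≡ true → i ≡ j
==⇒≡ Fin.zero Fin.zero _ = refl
==⇒≡ (Fin.suc i) (Fin.suc j) e = cong Fin.suc (==⇒≡ i j e)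

==-refl : ∀ {n} (i : Fin n) → (i == i) ≡ true
==-refl Fin.zero = refl
==-refl (Fin.suc i) = ==-refl i

⟦_⟧ : Bool → ℕ
⟦ true ⟧ = 1
⟦ false ⟧ = 0

count : (A → Bool) → List A → ℕ
count p xs = length (filterᵇ p xs)

∑ : List A → (A → ℕ) → ℕ
∑ xs f = sum (map f xs)

count-∑ : (p : A → Bool) (xs : List A) → count p xs ≡ ∑ xs (⟦_⟧ ∘ p)
count-∑ p [] = refl
count-∑ p (x ∷ xs) with p x
... | true = cong suc (count-∑ p xs)
... | false = count-∑ p xs

count-filter : (p q : A → Bool) (xs : List A) → count p (filterᵇ q xs) ≡ count (λ x → q x ∧ p x) xs
count-filter p q [] = refl
count-filter p q (x ∷ xs) with q x
... | false = count-filter p q xs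
... | true with p x
...   | true = cong suc (count-filter p q xs)
...   | false = count-filter p q xs

∑-cong : ∀ {f g : A → ℕ} (xs : List A) → (∀ x → f x ≡ g x) → ∑ xs f ≡ ∑ xs g
∑-cong xs e = cong sum (map-cong e xs)

∑-map : (h : A → B) (xs : List A) (f : B → ℕ) → ∑ (map h xs) f ≡ ∑ xs (f ∘ h)
∑-map h xs f = cong sum (sym (map-∘ xs))

∑-↭ : ∀ {xs ys : List A} (f : A → ℕ) → xs ↭ ys → ∑ xs f ≡ ∑ ys f
∑-↭ f p = sum-↭ (map⁺ f p)

∑-+ : (xs : List A) (f g : A → ℕ) → ∑ xs (λ x → f x + g x) ≡ ∑ xs f + ∑ xs g
∑-+ [] f g = refl
∑-+ (x ∷ xs) f g rewrite ∑-+ xs f g = interchange (f x) (g x) (∑ xs f) (∑ xs g)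

∑-0 : (xs : List A) → ∑ xs (λ _ → 0) ≡ 0
∑-0 [] = refl
∑-0 (x ∷ xs) = ∑-0 xs

∑-swap : (xs : List A) (ys : List B) (f : A → B → ℕ) →
         ∑ xs (λ x → ∑ ys (f x)) ≡ ∑ ys (λ y → ∑ xs (λ x → f x y))
∑-swap [] ys f = sym (∑-0 ys)
∑-swap (x ∷ xs) ys f = trans (cong (∑ ys (f x) +_) (∑-swap xs ys f)) (sym (∑-+ ys (f x) _))

∑-++ : (xs ys : List A) (f : A → ℕ) → ∑ (xs ++ ys) f ≡ ∑ xs f + ∑ ys f
∑-++ [] ys f = refl
∑-++ (x ∷ xs) ys f rewrite ∑-++ xs ys f = sym (+-assoc (f x) _ _)

∑-concatMap : (h : A → List B) (xs : List A) (f : B → ℕ) → ∑ (concatMap h xs) f ≡ ∑ xs (λ x → ∑ (h x) f)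
∑-concatMap h [] f = refl
∑-concatMap h (x ∷ xs) f = trans (∑-++ (h x) (concatMap h xs) f) (cong (∑ (h x) f +_) (∑-concatMap h xs f))

∑-mono : ∀ {f g : A → ℕ} (xs : List A) → (∀ x → f x ≤ g x) → ∑ xs f ≤ ∑ xs g
∑-mono [] e = z≤n
∑-mono (x ∷ xs) e = +-mono-≤ (e x) (∑-mono xs e)

∑-*ˡ : (xs : List A) (k : ℕ) (f : A → ℕ) → ∑ xs (λ x → k * f x) ≡ k * ∑ xs f
∑-*ˡ [] k f = sym (*-zeroʳ k)
∑-*ˡ (x ∷ xs) k f rewrite ∑-*ˡ xs k f = sym (*-distribˡ-+ k (f x) _)

count-cong : {p q : A → Bool} (xs : List A) → (∀ x → p x ≡ q x) → count p xs ≡ count q xs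
count-cong {p = p} {q} xs e = trans (count-∑ p xs) (trans (∑-cong xs (λ x → cong ⟦_⟧ (e x))) (sym (count-∑ q xs)))

count-mono : {p q : A → Bool} (xs : List A) → (∀ x → p x ≡ true → q x ≡ true) → count p xs ≤ count q xs
count-mono {p = p} {q} xs e = subst₂ _≤_ (sym (count-∑ p xs)) (sym (count-∑ q xs)) (∑-mono xs pointwise)
  where
  pointwise : ∀ x → ⟦ p x ⟧ ≤ ⟦ q x ⟧
  pointwise x with p x in px
  ... | false = z≤n
  ... | true rewrite e x px = ≤-refl

count-true : (xs : List A) → count (λ _ → true) xs ≡ length xs
count-true [] = refl
count-true (x ∷ xs) = cong suc (count-true xs)

count-not : (p : A → Bool) (xs : List A) → count p xs + count (not ∘ p) xs ≡ length xs
count-not p [] = refl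
count-not p (x ∷ xs) with p x
... | true = cong suc (count-not p xs)
... | false = trans (+-suc _ _) (cong suc (count-not p xs))

∈-filterᵇ⁺ : (p : A → Bool) {x : A} {xs : List A} → x ∈ xs → p x ≡ true → x ∈ filterᵇ p xs
∈-filterᵇ⁺ p x∈ px = ∈-filter⁺ (T? ∘ p) x∈ (subst T (sym px) tt)

∈-filterᵇ⁻ : (p : A → Bool) {x : A} {xs : List A} → x ∈ filterᵇ p xs → x ∈ xs × p x ≡ true
∈-filterᵇ⁻ p {x} {xs} x∈ with ∈-filter⁻ (T? ∘ p) {xs = xs} x∈
... | x∈′ , px with p x
...   | true = x∈′ , refl

∑-δ : ∀ {n} (v : Fin n) (f : Fin n → ℕ) → ∑ (allFin n) (λ i → ⟦ v == i ⟧ * f i) ≡ f v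
∑-δ {n} v f = go (allFin n) (Unique.allFin⁺ n) (∈-allFin v)
  where
  zero-∑ : ∀ xs → All (λ x → ¬ v ≡ x) xs → ∑ xs (λ i → ⟦ v == i ⟧ * f i) ≡ 0
  zero-∑ [] _ = refl
  zero-∑ (x ∷ xs) (v≢x ∷ r) with v == x in e
  ... | true = contradiction (==⇒≡ v x e) v≢x
  ... | false = zero-∑ xs r
  go : ∀ xs → Unique xs → v ∈ xs → ∑ xs (λ i → ⟦ v == i ⟧ * f i) ≡ f v
  go (x ∷ xs) (x∉ ∷ u) (here refl) rewrite ==-refl v | zero-∑ xs x∉ =
    trans (+-identityʳ _) (+-identityʳ _)
  go (x ∷ xs) (x∉ ∷ u) (there v∈) with v == x in e
  ... | true = contradiction (sym (==⇒≡ v x e)) (All.lookup x∉ v∈)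
  ... | false = go xs u v∈

lt-asym : ∀ m n → (m <ᵇ n) ≡ true → (n <ᵇ m) ≡ true → ⊥
lt-asym zero (suc n) _ ()
lt-asym (suc m) (suc n) p q = lt-asym m n p q

lt-irrefl : ∀ m → (m <ᵇ m) ≡ false
lt-irrefl zero = refl
lt-irrefl (suc m) = lt-irrefl m

≤ᵇ-sound : ∀ m k → (m ≤ᵇ k) ≡ true → m ≤ k
≤ᵇ-sound m k e = ≤ᵇ⇒≤ m k (subst T (sym e) _)

<ᵇ-sound : ∀ m k → (m <ᵇ k) ≡ true → m < k
<ᵇ-sound m k e = <ᵇ⇒< m k (subst T (sym e) _)

≡ᵇ-refl : ∀ k → (k ≡ᵇ k) ≡ true
≡ᵇ-refl zero = refl
≡ᵇ-refl (suc k) = ≡ᵇ-refl k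

≡ᵇ-sound : ∀ m k → (m ≡ᵇ k) ≡ true → m ≡ k
≡ᵇ-sound zero zero _ = refl
≡ᵇ-sound (suc m) (suc k) e = cong suc (≡ᵇ-sound m k e)

≤ᵇ-complete : ∀ {m k} → m ≤ k → (m ≤ᵇ k) ≡ true
≤ᵇ-complete z≤n = refl
≤ᵇ-complete {suc m} {suc k} (s≤s z≤n) = refl
≤ᵇ-complete {suc (suc m)} {suc (suc k)} (s≤s e@(s≤s _)) = ≤ᵇ-complete e

≮ᵇ⇒≥ : ∀ x y → (x <ᵇ y) ≡ false → y ≤ x
≮ᵇ⇒≥ x zero _ = z≤n
≮ᵇ⇒≥ (suc x) (suc y) e = s≤s (≮ᵇ⇒≥ x y e)

count-++ : (p : A → Bool) (xs ys : List A) → count p (xs ++ ys) ≡ count p xs + count p ys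
count-++ p [] ys = refl
count-++ p (x ∷ xs) ys with p x
... | true = cong suc (count-++ p xs ys)
... | false = count-++ p xs ys

∑-const : (xs : List A) (f : A → ℕ) (k : ℕ) → (∀ {x} → x ∈ xs → f x ≡ k) → ∑ xs f ≡ length xs * k
∑-const [] f k e = refl
∑-const (x ∷ xs) f k e = cong₂ _+_ (e (here refl)) (∑-const xs f k (λ x∈ → e (there x∈)))

count-skip : (p : A → Bool) (x : A) (xs : List A) → p x ≡ false → count p (x ∷ xs) ≡ count p xs
count-skip p x xs e with p x
... | false = refl

count-↭ : (p : A → Bool) {xs ys : List A} → xs ↭ ys → count p xs ≡ count p ys
count-↭ p {xs} {ys} e = trans (count-∑ p xs) (trans (∑-↭ _ e) (sym (count-∑ p ys)))

count-map : (p : B → Bool) (f : A → B) (xs : List A) → count p (map f xs) ≡ count (p ∘ f) xs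
count-map p f [] = refl
count-map p f (x ∷ xs) with p (f x)
... | true = cong suc (count-map p f xs)
... | false = count-map p f xs

filterᵇ-↭ : (p : A → Bool) (xs : List A) → filterᵇ p xs ++ filterᵇ (not ∘ p) xs ↭ xs
filterᵇ-↭ p [] = ↭-refl
filterᵇ-↭ p (x ∷ xs) with p x
... | true = prep x (filterᵇ-↭ p xs)
... | false = ↭-trans (shift x (filterᵇ p xs) _) (prep x (filterᵇ-↭ p xs))

if-true : {b : Bool} {x y : A} → b ≡ true → (if b then x else y) ≡ x
if-true refl = refl

any-++ˡ : (p : A → Bool) (xs ys : List A) → any p xs ≡ true → any p (xs ++ ys) ≡ true
any-++ˡ p xs ys e with any-witness p xs e
... | x , x∈ , px = any-true p (∈-++⁺ˡ x∈) px

filterᵇ-++ : (p : A → Bool) (xs ys : List A) → filterᵇ p (xs ++ ys) ≡ filterᵇ p xs ++ filterᵇ p ys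
filterᵇ-++ p = filter-++ (T? ∘ p)

any-filterᵇ : (p q : A → Bool) (xs : List A) → any (λ x → p x ∧ q x) xs ≡ any q (filterᵇ p xs)
any-filterᵇ p q [] = refl
any-filterᵇ p q (x ∷ xs) with p x
... | true = cong (q x ∨_) (any-filterᵇ p q xs)
... | false = any-filterᵇ p q xs

Unique-⊆-length : {xs ys : List A} → Unique xs → (∀ {x} → x ∈ xs → x ∈ ys) → length xs ≤ length ys
Unique-⊆-length {xs = []} _ _ = z≤n
Unique-⊆-length {xs = x ∷ xs} {ys} (x∉ ∷ u) sub with ∈-∃++ (sub (here refl))
... | as , bs , refl = subst (suc (length xs) ≤_) (sym (↭-length (shift x as bs))) (s≤s (Unique-⊆-length u sub′))
  where
  sub′ : ∀ {y} → y ∈ xs → y ∈ as ++ bs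
  sub′ {y} y∈ with ∈-++⁻ as (sub (there y∈))
  ... | inj₁ p = ∈-++⁺ˡ p
  ... | inj₂ (here refl) = contradiction refl (All.lookup x∉ y∈)
  ... | inj₂ (there p) = ∈-++⁺ʳ as p

count-< : {p q : A → Bool} {xs : List A} {x : A} → (∀ y → q y ≡ true → p y ≡ true) →
  x ∈ xs → p x ≡ true → q x ≡ false → count q xs < count p xs
count-< {p = p} {q} {x ∷ xs} sub (here refl) px qx rewrite px | qx = s≤s (count-mono xs sub)
count-< {p = p} {q} {y ∷ xs} sub (there x∈) px qx with q y in qy
... | true rewrite sub y qy = s≤s (count-< sub x∈ px qx)
... | false with p y
...   | true = m≤n⇒m≤1+n (count-< sub x∈ px qx)
...   | false = count-< sub x∈ px qx

-- Edges, degrees and sums over pairs of vertices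

module _ (G : Graph) where

  private
    V = Fin (n G)
    vs = allFin (n G)

  _<ᶠ_ : V → V → Bool
  i <ᶠ j = toℕ i <ᵇ toℕ j

  adj-irrefl : ∀ v → adj G v v ≡ false
  adj-irrefl v rewrite lt-irrefl (toℕ v) = refl

  adj-sym : ∀ i j → adj G i j ≡ adj G j i
  adj-sym i j with toℕ i <ᵇ toℕ j in p | toℕ j <ᵇ toℕ i in q
  ... | true  | true  = ⊥-elim (lt-asym (toℕ i) (toℕ j) p q)
  ... | true  | false = refl
  ... | false | true  = refl
  ... | false | false = refl

  ∑₂ : (V → V → ℕ) → ℕ
  ∑₂ f = ∑ vs (λ i → ∑ vs (f i))

  count-pairs : (F : V × V → Bool) → count F (edges G) ≡ ∑₂ (λ i j → ⟦ (i <ᶠ j) ∧ (adj G i j ∧ F (i , j)) ⟧)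
  count-pairs F = begin
    count F (edges G) ≡⟨ count-filter F _ (pairs (n G)) ⟩
    count F′ (pairs (n G)) ≡⟨ count-filter F′ _ all² ⟩
    count F″ all² ≡⟨ count-∑ F″ all² ⟩
    ∑ all² (⟦_⟧ ∘ F″) ≡⟨ ∑-concatMap (λ i → map (i ,_) vs) vs _ ⟩
    ∑ vs (λ i → ∑ (map (i ,_) vs) (⟦_⟧ ∘ F″)) ≡⟨ ∑-cong vs (λ i → ∑-map (i ,_) vs _) ⟩
    _ ∎
    where
    open ≡-Reasoning
    all² = concatMap (λ i → map (i ,_) vs) vs
    F′ F″ : V × V → Bool
    F′ e = uncurry (adj G) e ∧ F e
    F″ e = (proj₁ e <ᶠ proj₂ e) ∧ F′ e

  Symmetric : (V → V → Bool) → Set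
  Symmetric F = ∀ i j → F i j ≡ F j i

  -- Counting every edge from both ends removes the condition i < j. The right-hand side can be
  -- reindexed along any bijection of the vertices.
  handshake : (F : V → V → Bool) → Symmetric F →
    count (uncurry F) (edges G) + count (uncurry F) (edges G) ≡ ∑₂ (λ i j → ⟦ adj G i j ∧ F i j ⟧)
  handshake F F-sym = begin
    c + c ≡⟨ cong₂ _+_ (count-pairs (uncurry F)) (trans (count-pairs (uncurry F)) (∑-swap vs vs _)) ⟩
    ∑₂ g + ∑₂ (λ i j → g j i) ≡⟨ ∑-+ vs _ _ ⟨
    ∑ vs (λ i → ∑ vs (g i) + ∑ vs (λ j → g j i)) ≡⟨ ∑-cong vs (λ i → sym (∑-+ vs (g i) (λ j → g j i))) ⟩
    ∑₂ (λ i j → g i j + g j i) ≡⟨ ∑-cong vs (λ i → ∑-cong vs (pointwise i)) ⟩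
    _ ∎
    where
    open ≡-Reasoning
    c = count (uncurry F) (edges G)
    g : V → V → ℕ
    g i j = ⟦ (i <ᶠ j) ∧ (adj G i j ∧ F i j) ⟧
    pointwise : ∀ i j → g i j + g j i ≡ ⟦ adj G i j ∧ F i j ⟧
    pointwise i j rewrite F-sym j i with toℕ i <ᵇ toℕ j in p | toℕ j <ᵇ toℕ i in q
    ... | true  | true  = ⊥-elim (lt-asym (toℕ i) (toℕ j) p q)
    ... | true  | false = +-identityʳ _
    ... | false | true  = refl
    ... | false | false = refl

  degree-∑ : ∀ v → degree G v ≡ ∑ vs (λ w → ⟦ adj G v w ⟧)
  degree-∑ v = count-∑ (adj G v) vs

  degree-sum : ∑ vs (degree G) ≡ ∣E∣ G + ∣E∣ G
  degree-sum = begin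
    ∑ vs (degree G) ≡⟨ ∑-cong vs (λ v → trans (degree-∑ v) (∑-cong vs (λ w → cong ⟦_⟧ (sym (∧-identityʳ (adj G v w)))))) ⟩
    ∑₂ (λ i j → ⟦ adj G i j ∧ true ⟧) ≡⟨ handshake (λ _ _ → true) (λ _ _ → refl) ⟨
    count (λ _ → true) (edges G) + count (λ _ → true) (edges G) ≡⟨ cong (λ k → k + k) (count-true (edges G)) ⟩
    _ ∎
    where open ≡-Reasoning

  ∈-edges⁺ : ∀ {i j} → adj G i j ≡ true → (i <ᶠ j) ≡ true → (i , j) ∈ edges G
  ∈-edges⁺ {i} {j} a l = ∈-filterᵇ⁺ (uncurry (adj G))
      (∈-filterᵇ⁺ (λ p → proj₁ p <ᶠ proj₂ p) (∈-concatMap⁺ (λ i → map (i ,_) vs) (Any.map (λ { refl → ∈-map⁺ (i ,_) (∈-allFin j) }) (∈-allFin i))) l) a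

  ∈-edges⁻ : ∀ {i j} → (i , j) ∈ edges G → adj G i j ≡ true
  ∈-edges⁻ e∈ = proj₂ (∈-filterᵇ⁻ (uncurry (adj G)) {xs = pairs (n G)} e∈)

  -- Replaces the ordered edge list by the neighbours of v, a form that isomorphisms preserve.
  any-incident : (F : V → V → Bool) → Symmetric F → ∀ v →
    any (λ e → uncurry F e ∧ incident v e) (edges G) ≡ any (λ w → adj G v w ∧ F v w) vs
  any-incident F F-sym v = bool-ext to from
    where
    to : any (λ e → uncurry F e ∧ incident v e) (edges G) ≡ true → any (λ w → adj G v w ∧ F v w) vs ≡ true
    to t with any-witness _ (edges G) t
    ... | (i , j) , e∈ , p with F i j in f | v == i in q
    ...   | true | true rewrite ==⇒≡ v i q = any-allFin _ j (∧-intro (∈-edges⁻ e∈) f)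
    ...   | true | false rewrite ==⇒≡ v j p =
              any-allFin _ i (∧-intro (trans (adj-sym j i) (∈-edges⁻ e∈)) (trans (F-sym j i) f))
    from : any (λ w → adj G v w ∧ F v w) vs ≡ true → any (λ e → uncurry F e ∧ incident v e) (edges G) ≡ true
    from t with any-witness _ vs t
    ... | w , _ , p with ∧-true {adj G v w} p | toℕ v <ᵇ toℕ w in l | toℕ w <ᵇ toℕ v in m
    ...   | a , f | true  | _ =
            any-true _ (∈-edges⁺ a l) (∧-intro f (cong (_∨ (v == w)) (==-refl v)))
    ...   | a , f | false | true =
            any-true _ (∈-edges⁺ (trans (adj-sym w v) a) m)
              (∧-intro (trans (F-sym w v) f) (trans (cong ((v == w) ∨_) (==-refl v)) (∨-zeroʳ _)))
    ...   | a , f | false | false = ⊥-elim (true≢false a (no-adj v w l m))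
      where
      no-adj : ∀ v w → (v <ᶠ w) ≡ false → (w <ᶠ v) ≡ false → adj G v w ≡ false
      no-adj v w l m rewrite l | m = refl

edge-∈ : ∀ G x y → adj G x y ≡ true → (x , y) ∈ edges G ⊎ (y , x) ∈ edges G
edge-∈ G x y xy = by-order (toℕ x <ᵇ toℕ y) (toℕ y <ᵇ toℕ x) refl refl
  where
  by-order : ∀ b c → (toℕ x <ᵇ toℕ y) ≡ b → (toℕ y <ᵇ toℕ x) ≡ c → (x , y) ∈ edges G ⊎ (y , x) ∈ edges G
  by-order true _ l _ = inj₁ (∈-edges⁺ G xy l)
  by-order false true _ m = inj₂ (∈-edges⁺ G (trans (adj-sym G y x) xy) m)
  by-order false false l m = ⊥-elim (true≢false xy (none l m))
    where
    none : (toℕ x <ᵇ toℕ y) ≡ false → (toℕ y <ᵇ toℕ x) ≡ false → adj G x y ≡ false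
    none l m rewrite l | m = refl

-- Walks

walk-start : ∀ {G P x y} → Walk G P x y → P x
walk-start ([] p) = p
walk-start ((p , _) ∷ _) = p

module _ {G : Graph} {P : Fin (n G) → Set} where

  walk-snoc : ∀ {x y z} → Walk G P x y → P z → adj G y z ≡ true → Walk G P x z
  walk-snoc ([] p) pz yz = (p , yz) ∷ [] pz
  walk-snoc (s ∷ w) pz yz = s ∷ walk-snoc w pz yz

  _⋈_ : ∀ {x y z} → Walk G P x y → Walk G P y z → Walk G P x z
  [] _ ⋈ w = w
  (s ∷ v) ⋈ w = s ∷ (v ⋈ w)

  walk-reverse : ∀ {x y} → Walk G P x y → Walk G P y x
  walk-reverse ([] p) = [] p
  walk-reverse {x} (_∷_ {y = y} (p , xy) w) = walk-snoc (walk-reverse w) p (trans (adj-sym G y x) xy)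

  walk-map : ∀ {Q : Fin (n G) → Set} {x y} → (∀ {v} → P v → Q v) → Walk G P x y → Walk G Q x y
  walk-map f ([] p) = [] (f p)
  walk-map f ((p , a) ∷ w) = (f p , a) ∷ walk-map f w

-- Consequences of internal 4-connectivity

≅-sym : ∀ {G H} → G ≅ H → H ≅ G
≅-sym {G} {H} φ = record
  { to = from ; from = to ; from∘to = to∘from ; to∘from = from∘to
  ; adj-pres = λ x y → trans (sym (adj-pres (from x) (from y))) (cong₂ (adj H) (to∘from x) (to∘from y)) }
  where open _≅_ φ

≅-trans : ∀ {G H K} → G ≅ H → H ≅ K → G ≅ K
≅-trans φ ψ = record
  { to = B.to ∘ A.to ; from = A.from ∘ B.from
  ; from∘to = λ x → trans (cong A.from (B.from∘to _)) (A.from∘to x)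
  ; to∘from = λ x → trans (cong B.to (A.to∘from _)) (B.to∘from x)
  ; adj-pres = λ x y → trans (B.adj-pres _ _) (A.adj-pres x y) }
  where module A = _≅_ φ
        module B = _≅_ ψ

-- Cancels the doubling that `handshake` introduces.
double-injective : ∀ m k → m + m ≡ k + k → m ≡ k
double-injective zero zero _ = refl
double-injective (suc m) (suc k) e =
  cong suc (double-injective m k (suc-injective (trans (sym (+-suc m m)) (trans (suc-injective e) (+-suc k k)))))

-- With at least four edges on either side, the triangle and the star, which have three, drop out of
-- the definition, and the two sides become interchangeable. Symmetry of X makes its pullback along
-- an isomorphism meaningful.
Robust : Graph → Set
Robust G = ∀ X → Symmetric G X → 4 ≤ ∣X∣ G X → 4 ≤ ∣Y∣ G X → 4 ≤ ∣VXY∣ G X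

-- Invariance under isomorphism

module Transport {G H : Graph} (φ : G ≅ H) where
  open _≅_ φ

  to-injective : ∀ {x y} → to x ≡ to y → x ≡ y
  to-injective {x} {y} e = trans (sym (from∘to x)) (trans (cong from e) (from∘to y))

  -- Both lists are free of repetitions and contain every vertex of H, hence they agree as bags.
  to-↭ : map to (allFin (n G)) ↭ allFin (n H)
  to-↭ = ∼bag⇒↭ (unique∧set⇒bag (Unique.map⁺ to-injective (Unique.allFin⁺ _)) (Unique.allFin⁺ _)
    (λ {y} → mk⇔ (λ _ → ∈-allFin y) (λ _ → subst (_∈ _) (to∘from y) (∈-map⁺ to (∈-allFin (from y))))))

  ∑-transport : ∀ f → ∑ (allFin (n H)) f ≡ ∑ (allFin (n G)) (f ∘ to)
  ∑-transport f = trans (sym (∑-↭ f to-↭)) (∑-map to (allFin (n G)) f)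

  pull : EdgeSet H → EdgeSet G
  pull X i j = X (to i) (to j)

  count-edges : ∀ F → Symmetric H F → count (uncurry F) (edges H) ≡ count (uncurry (pull F)) (edges G)
  count-edges F F-sym = double-injective _ _ (begin
    _ ≡⟨ handshake H F F-sym ⟩
    ∑₂ H (λ i j → ⟦ adj H i j ∧ F i j ⟧) ≡⟨ ∑-transport _ ⟩
    _ ≡⟨ ∑-cong (allFin (n G)) (λ i → trans (∑-transport _)
           (∑-cong (allFin (n G)) (λ j → cong (λ b → ⟦ b ∧ F (to i) (to j) ⟧) (adj-pres i j)))) ⟩
    ∑₂ G (λ i j → ⟦ adj G i j ∧ pull F i j ⟧) ≡⟨ handshake G (pull F) (λ i j → F-sym (to i) (to j)) ⟨
    _ ∎)
    where open ≡-Reasoning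

  ∣E∣-≅ : ∣E∣ G ≡ ∣E∣ H
  ∣E∣-≅ = trans (sym (count-true (edges G)))
    (trans (sym (count-edges (λ _ _ → true) (λ _ _ → refl))) (count-true (edges H)))

  incident-≅ : ∀ F → Symmetric H F → ∀ v →
    any (λ e → uncurry (pull F) e ∧ incident v e) (edges G) ≡ any (λ e → uncurry F e ∧ incident (to v) e) (edges H)
  incident-≅ F F-sym v = trans (any-incident G (pull F) (λ i j → F-sym (to i) (to j)) v)
      (trans (bool-ext f g) (sym (any-incident H F F-sym (to v))))
    where
    f : any (λ w → adj G v w ∧ pull F v w) (allFin (n G)) ≡ true → any (λ w → adj H (to v) w ∧ F (to v) w) (allFin (n H)) ≡ true
    f t with any-witness _ (allFin (n G)) t
    ... | w , _ , p = any-allFin _ (to w) (trans (cong (_∧ F (to v) (to w)) (adj-pres v w)) p)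
    g : any (λ w → adj H (to v) w ∧ F (to v) w) (allFin (n H)) ≡ true → any (λ w → adj G v w ∧ pull F v w) (allFin (n G)) ≡ true
    g t with any-witness _ (allFin (n H)) t
    ... | w , _ , p = any-allFin _ (from w) (trans (cong (_∧ pull F v (from w)) (sym (adj-pres v (from w))))
                        (trans (cong (λ u → adj H (to v) u ∧ F (to v) u) (to∘from w)) p))

  robust-≅ : Robust G → Robust H
  robust-≅ r X X-sym x y = subst (4 ≤_) V-≅
      (r (pull X) (λ i j → X-sym (to i) (to j)) (subst (4 ≤_) (count-edges X X-sym) x)
         (subst (4 ≤_) (count-edges (λ i j → not (X i j)) (λ i j → cong not (X-sym i j))) y))
    where
    open ≡-Reasoning
    V-≅ : ∣VXY∣ G (pull X) ≡ ∣VXY∣ H X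
    V-≅ = begin
      ∣VXY∣ G (pull X) ≡⟨ count-cong (allFin (n G)) (λ v → cong₂ _∧_ (incident-≅ X X-sym v)
                            (incident-≅ (λ i j → not (X i j)) (λ i j → cong not (X-sym i j)) v)) ⟩
      count (inVXY H X ∘ to) (allFin (n G)) ≡⟨ count-∑ _ (allFin (n G)) ⟩
      ∑ (allFin (n G)) (λ v → ⟦ inVXY H X (to v) ⟧) ≡⟨ ∑-transport _ ⟨
      ∑ (allFin (n H)) (λ v → ⟦ inVXY H X v ⟧) ≡⟨ count-∑ _ (allFin (n H)) ⟨
      ∣VXY∣ H X ∎

module _ (G : Graph) where

  private
    V = Fin (n G)
    vs = allFin (n G)

  adj⇒≢ : ∀ {i j} → adj G i j ≡ true → ¬ i ≡ j
  adj⇒≢ {i} a refl = true≢false a (adj-irrefl G i)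

  δ : V → V → V → V → ℕ
  δ a b i j = ⟦ a == i ⟧ * ⟦ b == j ⟧

  ∑₂-δ : ∀ a b → ∑₂ G (δ a b) ≡ 1
  ∑₂-δ a b = begin
    ∑₂ G (δ a b) ≡⟨ ∑-cong vs (λ i → ∑-*ˡ vs ⟦ a == i ⟧ _) ⟩
    ∑ vs (λ i → ⟦ a == i ⟧ * ∑ vs (λ j → ⟦ b == j ⟧)) ≡⟨ ∑-δ a _ ⟩
    ∑ vs (λ j → ⟦ b == j ⟧) ≡⟨ ∑-cong vs (λ j → sym (*-identityʳ _)) ⟩
    ∑ vs (λ j → ⟦ b == j ⟧ * 1) ≡⟨ ∑-δ b _ ⟩
    1 ∎
    where open ≡-Reasoning

  link : V → V → V → V → Bool
  link a b i j = ((a == i) ∧ (b == j)) ∨ ((b == i) ∧ (a == j))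

  link-sym : ∀ a b → Symmetric G (link a b)
  link-sym a b i j rewrite ∧-comm (a == i) (b == j) | ∧-comm (b == i) (a == j) = ∨-comm ((b == j) ∧ (a == i)) _

  ∑₂-+ : ∀ f g → ∑₂ G (λ i j → f i j + g i j) ≡ ∑₂ G f + ∑₂ G g
  ∑₂-+ f g = trans (∑-cong vs (λ i → ∑-+ vs (f i) (g i))) (∑-+ vs _ _)

  ∑₂-mono : ∀ f g → (∀ i j → f i j ≤ g i j) → ∑₂ G f ≤ ∑₂ G g
  ∑₂-mono f g e = ∑-mono vs (λ i → ∑-mono vs (e i))

  ⟦∨⟧≤ : ∀ a b → ⟦ a ∨ b ⟧ ≤ ⟦ a ⟧ + ⟦ b ⟧
  ⟦∨⟧≤ true b = s≤s z≤n
  ⟦∨⟧≤ false b = ≤-refl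

  ⟦∧⟧ : ∀ a b → ⟦ a ∧ b ⟧ ≡ ⟦ a ⟧ * ⟦ b ⟧
  ⟦∧⟧ true b = sym (+-identityʳ _)
  ⟦∧⟧ false b = refl

  ∑₂-link≤ : ∀ a b → ∑₂ G (λ i j → ⟦ link a b i j ⟧) ≤ 2
  ∑₂-link≤ a b = subst (∑₂ G (λ i j → ⟦ link a b i j ⟧) ≤_)
    (trans (∑₂-+ (δ a b) (δ b a)) (cong₂ _+_ (∑₂-δ a b) (∑₂-δ b a)))
    (∑₂-mono _ _ (λ i j → subst₂ (λ x y → ⟦ link a b i j ⟧ ≤ x + y) (⟦∧⟧ (a == i) (b == j)) (⟦∧⟧ (b == i) (a == j))
      (⟦∨⟧≤ ((a == i) ∧ (b == j)) ((b == i) ∧ (a == j)))))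

  count-edges≤ : ∀ F → Symmetric G F → ∀ k → ∑₂ G (λ i j → ⟦ adj G i j ∧ F i j ⟧) ≤ k + k → count (uncurry F) (edges G) ≤ k
  count-edges≤ F F-sym k le = half _ _ (subst (_≤ k + k) (sym (handshake G F F-sym)) le)
    where
    half : ∀ m k → m + m ≤ k + k → m ≤ k
    half zero k _ = z≤n
    half (suc m) (suc k) (s≤s e) = s≤s (half m k (≤-pred (subst₂ _≤_ (+-suc m m) (+-suc k k) e)))

  -- The formula of `IsTriangle`, repeated so that a witness of the latter bounds |X| directly.
  triangle-edges : V → V → V → V → V → Bool
  triangle-edges a b c i j = ((incident a (i , j) ∧ incident b (i , j)) ∨ (incident b (i , j) ∧ incident c (i , j)))
           ∨ (incident a (i , j) ∧ incident c (i , j))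

  incident²⇒link : ∀ {a b i j} → ¬ a ≡ b → ¬ i ≡ j → incident a (i , j) ∧ incident b (i , j) ≡ true → link a b i j ≡ true
  incident²⇒link {a} {b} {i} {j} a≢b i≢j e with a == i in p | a == j in q | b == i in r | b == j in s
  ... | true  | _     | true | _ = contradiction (trans (==⇒≡ a i p) (sym (==⇒≡ b i r))) a≢b
  ... | true  | _     | false | true = refl
  ... | false | true  | true  | _ = refl
  ... | false | true  | false | true = contradiction (trans (==⇒≡ a j q) (sym (==⇒≡ b j s))) a≢b

  incident-sym : ∀ (v i j : V) → incident v (i , j) ≡ incident v (j , i)
  incident-sym v i j = ∨-comm (v == i) (v == j)

  -- An edge incident with two of the three vertices is the edge that joins them, and each of the
  -- three is met at most twice among the ordered pairs. The upper bound suffices, since it is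
  -- played against 4 ≤ |X|.
  count-triangle : ∀ a b c → adj G a b ≡ true → adj G b c ≡ true → adj G a c ≡ true →
    count (uncurry (triangle-edges a b c)) (edges G) ≤ 3
  count-triangle a b c ab bc ac = count-edges≤ (triangle-edges a b c) sym-tri 3 bound
    where
    sym-tri : Symmetric G (triangle-edges a b c)
    sym-tri i j rewrite incident-sym a i j | incident-sym b i j | incident-sym c i j = refl
    link≥ : ∀ a b i j → adj G a b ≡ true → adj G i j ≡ true → ⟦ incident a (i , j) ∧ incident b (i , j) ⟧ ≤ ⟦ link a b i j ⟧
    link≥ a b i j ab ij with incident a (i , j) ∧ incident b (i , j) in e
    ... | false = z≤n
    ... | true rewrite incident²⇒link {a} {b} {i} {j} (adj⇒≢ {a} {b} ab) (adj⇒≢ {i} {j} ij) e = ≤-refl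
    pointwise : ∀ i j → ⟦ adj G i j ∧ triangle-edges a b c i j ⟧ ≤ (⟦ link a b i j ⟧ + ⟦ link b c i j ⟧) + ⟦ link a c i j ⟧
    pointwise i j with adj G i j in ij
    ... | false = z≤n
    ... | true = ≤-trans (⟦∨⟧≤ ((incident a (i , j) ∧ incident b (i , j)) ∨ (incident b (i , j) ∧ incident c (i , j))) (incident a (i , j) ∧ incident c (i , j)))
      (+-mono-≤ (≤-trans (⟦∨⟧≤ (incident a (i , j) ∧ incident b (i , j)) (incident b (i , j) ∧ incident c (i , j)))
                  (+-mono-≤ (link≥ a b i j ab ij) (link≥ b c i j bc ij))) (link≥ a c i j ac ij))
    bound : ∑₂ G (λ i j → ⟦ adj G i j ∧ triangle-edges a b c i j ⟧) ≤ 6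
    bound = ≤-trans (∑₂-mono _ _ pointwise) (subst (_≤ 6)
      (sym (trans (∑₂-+ _ _) (cong (_+ _) (∑₂-+ _ _))))
      (+-mono-≤ (+-mono-≤ (∑₂-link≤ a b) (∑₂-link≤ b c)) (∑₂-link≤ a c)))

  -- An edge at v has v as exactly one of its ends, so the doubled count splits into two copies of
  -- the degree.
  count-star : ∀ v → count (incident v) (edges G) ≡ degree G v
  count-star v = double-injective _ _ (begin
    _ ≡⟨ handshake G (λ i j → incident v (i , j)) (incident-sym v) ⟩
    ∑₂ G (λ i j → ⟦ adj G i j ∧ incident v (i , j) ⟧) ≡⟨ ∑-cong vs (λ i → ∑-cong vs (pointwise i)) ⟩
    ∑₂ G (λ i j → f i j + f j i) ≡⟨ ∑₂-+ f (λ i j → f j i) ⟩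
    ∑₂ G f + ∑₂ G (λ i j → f j i) ≡⟨ cong₂ _+_ ∑f (trans (∑-swap vs vs _) ∑f) ⟩
    degree G v + degree G v ∎)
    where
    open ≡-Reasoning
    f : V → V → ℕ
    f i j = ⟦ v == i ⟧ * ⟦ adj G i j ⟧
    ∑f : ∑₂ G f ≡ degree G v
    ∑f = trans (∑-cong vs (λ i → ∑-*ˡ vs ⟦ v == i ⟧ _)) (trans (∑-δ v _) (sym (degree-∑ G v)))
    pointwise : ∀ i j → ⟦ adj G i j ∧ incident v (i , j) ⟧ ≡ f i j + f j i
    pointwise i j rewrite adj-sym G j i with adj G i j in ij | v == i in p | v == j in q
    ... | false | true  | true  = refl
    ... | false | true  | false = refl
    ... | false | false | true  = refl
    ... | false | false | false = refl
    ... | true | true  | true  = contradiction (trans (sym (==⇒≡ v i p)) (==⇒≡ v j q)) (adj⇒≢ ij)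
    ... | true | true  | false = refl
    ... | true | false | true  = refl
    ... | true | false | false = refl

  -- Equality |V(X,Y)| = 3 would make X a triangle or a star, hence a set of at most three edges.
  four-sided : Internally4Connected G → ∀ X → 4 ≤ ∣X∣ G X → ∣X∣ G X ≤ ∣Y∣ G X → 4 ≤ ∣VXY∣ G X
  four-sided (_ , i4c) X 4≤X X≤Y with i4c X (≤-trans (n≤1+n 3) 4≤X) X≤Y
  ... | 3≤V , small = ≤∧≢⇒< 3≤V (λ e → no-small (small (sym e)))
    where
    ∣X∣≡ : ∀ F → All (λ e → uncurry X e ≡ F e) (edges G) → ∣X∣ G X ≡ count F (edges G)
    ∣X∣≡ F = go (edges G)
      where
      go : ∀ es → All (λ e → uncurry X e ≡ F e) es → count (uncurry X) es ≡ count F es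
      go [] [] = refl
      go (e ∷ es) (p ∷ ps) rewrite p with F e
      ... | true = cong suc (go es ps)
      ... | false = go es ps
    no-small : IsTriangle G X ⊎ IsDegree3Star G X → ⊥
    no-small (inj₁ (a , b , c , ab , bc , ac , p)) =
      <⇒≱ 4≤X (subst (_≤ 3) (sym (∣X∣≡ _ p)) (count-triangle a b c ab bc ac))
    no-small (inj₂ (v , d , p)) =
      <⇒≱ 4≤X (≤-reflexive (trans (∣X∣≡ _ p) (trans (count-star v) d)))

  -- The definition speaks of the smaller side only; when that is Y, it is applied to the complement
  -- of X, which has the same boundary.
  i4c⇒robust : Internally4Connected G → Robust G
  i4c⇒robust i4c X _ 4≤X 4≤Y with ≤-total (∣X∣ G X) (∣Y∣ G X)
  ... | inj₁ X≤Y = four-sided i4c X 4≤X X≤Y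
  ... | inj₂ Y≤X = subst (4 ≤_) V-swap (four-sided i4c (λ i j → not (X i j)) 4≤Y (subst (∣Y∣ G X ≤_) X-swap Y≤X))
    where
    X-swap : ∣X∣ G X ≡ ∣Y∣ G (λ i j → not (X i j))
    X-swap = count-cong (edges G) (λ e → sym (not-involutive _))
    V-swap : ∣VXY∣ G (λ i j → not (X i j)) ≡ ∣VXY∣ G X
    V-swap = count-cong vs (λ v → trans (∧-comm (any (λ e → not (uncurry X e) ∧ incident v e) (edges G)) _)
      (cong (_∧ any (λ e → not (uncurry X e) ∧ incident v e) (edges G))
        (cong or (map-cong (λ e → cong (_∧ incident v e) (not-involutive _)) (edges G)))))

  degree-pred : ∀ v → suc (degree G v) ≤ n G
  degree-pred v = begin
    suc (degree G v) ≡⟨ +-comm 1 _ ⟩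
    degree G v + 1 ≡⟨ cong₂ _+_ (degree-∑ G v) (sym (∑-δ v (λ _ → 1))) ⟩
    ∑ vs (λ w → ⟦ adj G v w ⟧) + ∑ vs (λ w → ⟦ v == w ⟧ * 1) ≡⟨ ∑-+ vs _ _ ⟨
    ∑ vs (λ w → ⟦ adj G v w ⟧ + ⟦ v == w ⟧ * 1) ≤⟨ ∑-mono vs pointwise ⟩
    ∑ vs (λ _ → 1) ≡⟨ trans (sym (count-∑ (λ _ → true) vs)) (count-true vs) ⟩
    length vs ≡⟨ length-tabulate id ⟩
    n G ∎
    where
    open ≤-Reasoning
    pointwise : ∀ w → ⟦ adj G v w ⟧ + ⟦ v == w ⟧ * 1 ≤ 1
    pointwise w with adj G v w in a | v == w in e
    ... | true | true = contradiction (==⇒≡ v w e) (adj⇒≢ a)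
    ... | true | false = ≤-refl
    ... | false | true = ≤-refl
    ... | false | false = z≤n

  avoid : 4 ≤ n G → ∀ x y z → Σ V λ w → ¬ (w ≡ x ⊎ w ≡ y ⊎ w ≡ z)
  avoid 4≤n x y z = ¬∀⟶∃¬ _ _ (λ w → (w ≟ x) ⊎-dec (w ≟ y) ⊎-dec (w ≟ z)) (λ covered → <⇒≱ 4≤n (begin
    n G ≡⟨ length-tabulate id ⟨
    length vs ≡⟨ count-true vs ⟨
    count (λ _ → true) vs ≡⟨ count-∑ (λ _ → true) vs ⟩
    ∑ vs (λ _ → 1) ≤⟨ ∑-mono vs (λ w → pointwise w (covered w)) ⟩
    ∑ vs (λ w → ⟦ x == w ⟧ * 1 + (⟦ y == w ⟧ * 1 + ⟦ z == w ⟧ * 1)) ≡⟨ trans (∑-+ vs _ _) (cong₂ _+_ (∑-δ x _) (trans (∑-+ vs _ _) (cong₂ _+_ (∑-δ y _) (∑-δ z _)))) ⟩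
    3 ∎))
    where
    open ≤-Reasoning
    pointwise : ∀ w → w ≡ x ⊎ w ≡ y ⊎ w ≡ z → 1 ≤ ⟦ x == w ⟧ * 1 + (⟦ y == w ⟧ * 1 + ⟦ z == w ⟧ * 1)
    pointwise w (inj₁ refl) rewrite ==-refl w = s≤s z≤n
    pointwise w (inj₂ (inj₁ refl)) rewrite ==-refl w = m≤n⇒m≤o+n (⟦ x == w ⟧ * 1) (s≤s z≤n)
    pointwise w (inj₂ (inj₂ refl)) rewrite ==-refl w = m≤n⇒m≤o+n (⟦ x == w ⟧ * 1) (m≤n+m 1 (⟦ y == w ⟧ * 1))

  minimum-degree : ThreeConnected G → ∀ v → 3 ≤ degree G v
  minimum-degree (4≤n , connected) v = enough _ refl
    where
    -- All neighbours of v are deleted with a and b, so a walk from v to a fourth vertex w cannot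
    -- take its first step.
    separated : ∀ a b → ¬ v ≡ a → ¬ v ≡ b → (∀ w → adj G v w ≡ true → w ≡ a ⊎ w ≡ b) → ⊥
    separated a b v≢a v≢b nbrs with avoid 4≤n v a b
    ... | w , w∉ with connected a b v w (v≢a , v≢b) (w∉ ∘ inj₂ ∘ inj₁ , w∉ ∘ inj₂ ∘ inj₂)
    ...   | [] _ = w∉ (inj₁ refl)
    ...   | (_ , vx) ∷ walk with nbrs _ vx
    ...     | inj₁ e = proj₁ (walk-start walk) e
    ...     | inj₂ e = proj₂ (walk-start walk) e
    enough : ∀ ws → filterᵇ (adj G v) vs ≡ ws → 3 ≤ length ws
    enough ws eq = go ws (λ w∈ e → adj⇒≢ (proj₂ (∈-filterᵇ⁻ (adj G v) {xs = vs} (subst (_ ∈_) (sym eq) w∈))) e)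
        (λ w vw → subst (w ∈_) eq (∈-filterᵇ⁺ (adj G v) (∈-allFin w) vw))
      where
      go : ∀ ws → (∀ {w} → w ∈ ws → ¬ v ≡ w) → (∀ w → adj G v w ≡ true → w ∈ ws) → 3 ≤ length ws
      -- For an isolated v, any other vertex can play the deleted one.
      go [] _ nbrs = let a , a∉ = avoid 4≤n v v v ; v≢a = λ e → a∉ (inj₁ (sym e)) in
        ⊥-elim (separated a a v≢a v≢a (λ w vw → case nbrs w vw of λ ()))
      go (a ∷ []) ≢v nbrs = ⊥-elim (separated a a (≢v (here refl)) (≢v (here refl))
        (λ w vw → case nbrs w vw of λ { (here p) → inj₁ p }))
      go (a ∷ b ∷ []) ≢v nbrs = ⊥-elim (separated a b (≢v (here refl)) (≢v (there (here refl)))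
        (λ w vw → case nbrs w vw of λ { (here p) → inj₁ p ; (there (here p)) → inj₂ p }))
      go (_ ∷ _ ∷ _ ∷ _) _ _ = s≤s (s≤s (s≤s z≤n))

  count-link : ∀ a b → adj G a b ≡ true → count (uncurry (link a b)) (edges G) ≡ 1
  count-link a b ab = double-injective _ _ (begin
    _ ≡⟨ handshake G (link a b) (link-sym a b) ⟩
    ∑₂ G (λ i j → ⟦ adj G i j ∧ link a b i j ⟧) ≡⟨ ∑-cong vs (λ i → ∑-cong vs (pointwise i)) ⟩
    ∑₂ G (λ i j → δ a b i j + δ b a i j) ≡⟨ ∑₂-+ (δ a b) (δ b a) ⟩
    ∑₂ G (δ a b) + ∑₂ G (δ b a) ≡⟨ cong₂ _+_ (∑₂-δ a b) (∑₂-δ b a) ⟩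
    2 ∎)
    where
    open ≡-Reasoning
    pointwise : ∀ i j → ⟦ adj G i j ∧ link a b i j ⟧ ≡ δ a b i j + δ b a i j
    pointwise i j with a == i in p | b == j in q | b == i in r | a == j in s
    ... | true  | _     | true  | _     = contradiction (trans (==⇒≡ a i p) (sym (==⇒≡ b i r))) (adj⇒≢ ab)
    ... | _     | true  | _     | true  = contradiction (trans (==⇒≡ a j s) (sym (==⇒≡ b j q))) (adj⇒≢ ab)
    ... | true  | true  | false | false rewrite sym (==⇒≡ a i p) | sym (==⇒≡ b j q) | ab = refl
    ... | true  | false | false | _     = cong ⟦_⟧ (∧-comm (adj G i j) false)
    ... | false | _     | true  | false = cong ⟦_⟧ (∧-comm (adj G i j) false)
    ... | false | false | true  | true  rewrite sym (==⇒≡ b i r) | sym (==⇒≡ a j s) | adj-sym G b a | ab = refl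
    ... | false | _     | false | _     = cong ⟦_⟧ (∧-comm (adj G i j) false)

  -- Otherwise the star of v together with the edge a b is one side of a forbidden 3-separation.
  cubic-no-triangle : Robust G → 8 ≤ ∣E∣ G → ∀ v a b → degree G v ≡ 3 →
    adj G v a ≡ true → adj G v b ≡ true → adj G a b ≡ true → ⊥
  cubic-no-triangle robust 8≤E v a b d va vb ab =
      <⇒≱ (robust X X-sym (≤-reflexive (sym X≡4)) 4≤Y) (subst (∣VXY∣ G X ≤_) d (count-mono vs boundary))
    where
    X : V → V → Bool
    X i j = incident v (i , j) ∨ link a b i j
    X-sym : Symmetric G X
    X-sym i j = cong₂ _∨_ (incident-sym v i j) (link-sym a b i j)
    disjoint : ∀ i j → incident v (i , j) ∧ link a b i j ≡ false
    disjoint i j with v == i in p | v == j in q | a == i in r | b == j in s | b == i in t | a == j in u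
    ... | true  | _ | true  | _     | _     | _    = contradiction (trans (==⇒≡ v i p) (sym (==⇒≡ a i r))) (adj⇒≢ va)
    ... | true  | _ | false | _     | true  | _    = contradiction (trans (==⇒≡ v i p) (sym (==⇒≡ b i t))) (adj⇒≢ vb)
    ... | true  | _ | false | _     | false | _    = refl
    ... | false | true | _  | true  | _     | _    = contradiction (trans (==⇒≡ v j q) (sym (==⇒≡ b j s))) (adj⇒≢ vb)
    ... | false | true | _  | false | _     | true = contradiction (trans (==⇒≡ v j q) (sym (==⇒≡ a j u))) (adj⇒≢ va)
    ... | false | true | true  | false | true  | false = refl
    ... | false | true | true  | false | false | false = refl
    ... | false | true | false | false | true  | false = refl
    ... | false | true | false | false | false | false = refl
    ... | false | false | _ | _     | _     | _    = refl
    count-∨ : ∀ {A : Set} (p q : A → Bool) xs → (∀ x → p x ∧ q x ≡ false) → count (λ x → p x ∨ q x) xs ≡ count p xs + count q xs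
    count-∨ p q [] _ = refl
    count-∨ p q (x ∷ xs) dis with p x | q x | dis x
    ... | true  | false | _ = cong suc (count-∨ p q xs dis)
    ... | false | true  | _ = trans (cong suc (count-∨ p q xs dis)) (sym (+-suc _ _))
    ... | false | false | _ = count-∨ p q xs dis
    X≡4 : ∣X∣ G X ≡ 4
    X≡4 = trans (count-∨ (incident v) (uncurry (link a b)) (edges G) (λ e → disjoint (proj₁ e) (proj₂ e)))
      (cong₂ _+_ (trans (count-star v) d) (count-link a b ab))
    -- This is where eight edges are used: X takes four, and four remain.
    4≤Y : 4 ≤ ∣Y∣ G X
    4≤Y = +-cancelˡ-≤ 4 4 _ (subst (8 ≤_) (trans (sym (count-not (uncurry X) (edges G))) (cong (_+ ∣Y∣ G X) X≡4)) 8≤E)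
    -- All edges at v lie in X, so v is not in the boundary; the other ends of edges in X are
    -- neighbours of v. Hence the boundary has at most three vertices.
    boundary : ∀ w → inVXY G X w ≡ true → adj G v w ≡ true
    boundary w t with ∧-true {any (λ e → uncurry X e ∧ incident w e) (edges G)} t
    ... | x , y with any-witness _ vs (trans (sym (any-incident G X X-sym w)) x)
                   | any-witness _ vs (trans (sym (any-incident G (λ i j → not (X i j)) (λ i j → cong not (X-sym i j)) w)) y)
    ...   | u , _ , p | z , _ , q with v ≟ w
    ...     | yes refl rewrite ==-refl v = case proj₂ (∧-true {adj G v z} q) of λ ()
    ...     | no v≢w with ∧-true {adj G w u} p
    ...       | wu , Xwu with v == w in e | v == u in f | a == w in g | b == w in h
    ...         | true | _ | _ | _ = contradiction (==⇒≡ v w e) v≢w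
    ...         | false | true | _ | _ rewrite ==⇒≡ v u f = trans (adj-sym G u w) wu
    ...         | false | false | true | _ rewrite sym (==⇒≡ a w g) = va
    ...         | false | false | false | true rewrite sym (==⇒≡ b w h) = vb

-- Enumeration

-- `resid` is the number of neighbours still to be found among the unprocessed vertices; `row` lists
-- the adjacencies to the processed vertices, latest first.
record Cell : Set where
  constructor cell
  field
    size resid deg : ℕ
    row : List Bool

-- The test for a new edge whose ends have degrees d and d′; the entries of `es` are the degrees of
-- the processed vertices. A triangle is seen when the second of its vertices is processed, since
-- that fixes its last edge.
cubic-triangle-free : ℕ → List Bool → ℕ → List Bool → List ℕ → Bool
cubic-triangle-free d (r ∷ s) d′ (r′ ∷ s′) (e ∷ es) =
  not (r ∧ r′ ∧ ((d ≡ᵇ 3) ∨ (d′ ≡ᵇ 3) ∨ (e ≡ᵇ 3))) ∧ cubic-triangle-free d s d′ s′ es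
cubic-triangle-free _ _ _ _ _ = true

piece : Cell → List Cell → List Cell
piece (cell zero _ _ _) cs = cs
piece c@(cell (suc _) _ _ _) cs = c ∷ cs

module _ (d : ℕ) (s : List Bool) (es : List ℕ) where

  -- All vertices of the cell have the same degree and row, so one triangle test covers all c new
  -- edges.
  admissible : Cell → ℕ → ℕ → Bool
  admissible (cell k r d′ s′) left c =
    (c ≡ᵇ 0) ∨ ((c ≤ᵇ left) ∧ ((0 <ᵇ r) ∧ cubic-triangle-free d s d′ s′ es))

  splits : List Cell → ℕ → List (List Cell)
  splits [] zero = [] ∷ []
  splits [] (suc _) = []
  splits (cell k r d′ s′ ∷ cs) left = concatMap
    (λ c → if admissible (cell k r d′ s′) left c
           then map (λ x → piece (cell c (r ∸ 1) d′ (true ∷ s′)) (piece (cell (k ∸ c) r d′ (false ∷ s′)) x))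
                    (splits cs (left ∸ c))
           else [])
    (upTo (suc k))

-- The first argument counts the unprocessed vertices. A row is stored when its vertex is processed
-- and therefore covers only earlier vertices, so a leaf is a triangular adjacency matrix.
search : ℕ → List Cell → List ℕ → List (List Bool) → List (List (List Bool))
search zero _ es rows = rows ∷ []
search (suc f) [] es rows = []
search (suc f) (cell zero _ _ _ ∷ cs) es rows = search (suc f) cs es rows
search (suc f) (cell (suc k) r d s ∷ cs) es rows =
  concatMap (λ x → search f x (d ∷ es) (s ∷ rows)) (splits d s es (piece (cell k r d s) cs) r)

-- Runs through the degree sequences with k terms and sum S. Before any vertex is processed, the
-- residual is the whole degree.
initial : List ℕ → ℕ → ℕ → List (List Cell)
initial [] zero zero = [] ∷ []
initial [] _ _ = []
initial (d ∷ ds) k S = concatMap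
  (λ c → if c * d ≤ᵇ S then map (piece (cell c d d [])) (initial ds (k ∸ c) (S ∸ c * d)) else [])
  (upTo (suc k))

leaves : List ℕ → ℕ → ℕ → List (List (List Bool))
leaves ds k m = concatMap (λ cs → search k cs [] []) (initial ds k (m + m))

nth : List Bool → ℕ → Bool
nth [] _ = false
nth (b ∷ bs) zero = b
nth (b ∷ bs) (suc k) = nth bs k

-- Rows are stored latest first, so row i begins with vertex i + 1. This explains the offset; only
-- entries with i < j carry information, and `adj` consults no others.
entry : List (List Bool) → ℕ → ℕ → Bool
entry (s ∷ rows) zero (suc j) = nth s j
entry (s ∷ rows) (suc i) (suc j) = entry rows i j
entry _ _ _ = false

rowsGraph : List (List Bool) → Graph
rowsGraph rows = mkGraph (length rows) (λ i j → entry rows (toℕ i) (toℕ j))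

-- Soundness of the enumeration

module Enumerate (G : Graph)
  (cubic : ∀ v a b → degree G v ≡ 3 → adj G v a ≡ true → adj G v b ≡ true → adj G a b ≡ true → ⊥) where

  private
    V = Fin (n G)
    vs = allFin (n G)
    a = adj G
    deg = degree G

  record Fit (ps : List V) (r d : ℕ) (s : List Bool) (w : V) : Set where
    constructor fit
    field
      resid≡ : r + count id s ≡ d
      deg≡ : deg w ≡ d
      row≡ : map (a w) ps ≡ s
  open Fit

  Fits : List V → Cell → List V → Set
  Fits ps (cell k r d s) ws = length ws ≡ k × All (Fit ps r d s) ws

  -- The invariant of the search: `wss` realises the abstract cells by actual vertices of G.
  Cells : List V → List Cell → List (List V) → Set
  Cells ps = Pointwise (Fits ps)

  piece-fits : ∀ {ps} c {ws cs wss} → Fits ps c ws → Cells ps cs wss →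
    Σ (List (List V)) λ wss′ → Cells ps (piece c cs) wss′ × concat wss′ ≡ ws ++ concat wss
  piece-fits (cell zero r d s) {[]} {wss = wss} _ cells = wss , cells , refl
  piece-fits (cell (suc k) r d s) {ws} {wss = wss} f cells = ws ∷ wss , f ∷ cells , refl

  triangle-free : ∀ v w ps → a v w ≡ true →
    cubic-triangle-free (deg v) (map (a v) ps) (deg w) (map (a w) ps) (map deg ps) ≡ true
  triangle-free v w [] vw = refl
  triangle-free v w (u ∷ ps) vw with a v u in vu | a w u in wu
  ... | false | _ = triangle-free v w ps vw
  ... | true | false = triangle-free v w ps vw
  ... | true | true with deg v ≡ᵇ 3 in dv | deg w ≡ᵇ 3 in dw | deg u ≡ᵇ 3 in du
  ...   | true | _ | _ = ⊥-elim (cubic v w u (≡ᵇ-sound _ 3 dv) vw vu wu)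
  ...   | false | true | _ = ⊥-elim (cubic w v u (≡ᵇ-sound _ 3 dw) (trans (adj-sym G w v) vw) wu vu)
  ...   | false | false | true = ⊥-elim (cubic u v w (≡ᵇ-sound _ 3 du) (trans (adj-sym G u v) vu) (trans (adj-sym G u w) wu) vw)
  ...   | false | false | false = triangle-free v w ps vw

  module _ (v : V) (ps : List V) where

    -- From each cell the search takes as many vertices as v has neighbours there in G. The bound on
    -- processed neighbours keeps residuals from underflowing.
    splits-sound : ∀ {cs wss} → Cells ps cs wss →
      (∀ {w} → w ∈ concat wss → count (a w) (v ∷ ps) ≤ deg w) →
      Σ (List Cell) λ x → x ∈ splits (deg v) (map (a v) ps) (map deg ps) cs (count (a v) (concat wss)) ×
      Σ (List (List V)) λ wss′ → Cells (v ∷ ps) x wss′ × concat wss′ ↭ concat wss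
    splits-sound [] bound = [] , here refl , [] , [] , ↭-refl
    splits-sound {cell k r d s ∷ cs} {ws ∷ wss} ((len , fits) ∷ cells) bound
      with splits-sound cells (λ w∈ → bound (∈-++⁺ʳ ws w∈))
    ... | x , x∈ , wss₀ , cells₀ , perm₀ =
        _ , subst (λ l → new ∈ splits (deg v) (map (a v) ps) (map deg ps) (cell k r d s ∷ cs) l)
              (sym (count-++ (a v) ws (concat wss))) membership
          , proj₁ yes-piece , proj₁ (proj₂ yes-piece) , perm
      where
      c = count (a v) ws
      left = count (a v) (concat wss)
      -- If the residual were zero, the processed neighbours of w together with v would exceed its
      -- degree. So `r ∸ 1` is a true predecessor.
      resid : ∀ {w} → w ∈ ws → a v w ≡ true → Σ ℕ λ r′ → r ≡ suc r′
      resid {w} w∈ vw with All.lookup fits w∈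
      ... | fit p q t with bound (∈-++⁺ˡ w∈)
      ...   | le rewrite trans (adj-sym G w v) vw | q | sym p | sym t | count-map id (a w) ps =
              positive r le
        where
        positive : ∀ r → suc (count (a w) ps) ≤ r + count (a w) ps → Σ ℕ λ r′ → r ≡ suc r′
        positive zero le = ⊥-elim (<-irrefl refl le)
        positive (suc r) _ = r , refl
      no-fits : ∀ {w} → w ∈ filterᵇ (not ∘ a v) ws → Fit (v ∷ ps) r d (false ∷ s) w
      no-fits {w} w∈ with ∈-filterᵇ⁻ (not ∘ a v) {xs = ws} w∈
      ... | w∈ws , vw with All.lookup fits w∈ws
      ...   | fit p q t = fit p q (cong₂ _∷_ (trans (adj-sym G w v) (not-true vw)) t)
      yes-fits : ∀ {w} → w ∈ filterᵇ (a v) ws → Fit (v ∷ ps) (r ∸ 1) d (true ∷ s) w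
      yes-fits {w} w∈ with ∈-filterᵇ⁻ (a v) {xs = ws} w∈
      ... | w∈ws , vw with All.lookup fits w∈ws | resid w∈ws vw
      ...   | fit p q t | r′ , refl =
              fit (trans (+-suc r′ (count id s)) p) q (cong₂ _∷_ (trans (adj-sym G w v) vw) t)
      no-length : length (filterᵇ (not ∘ a v) ws) ≡ k ∸ c
      no-length = trans (sym (m+n∸m≡n c _)) (cong (_∸ c) (trans (count-not (a v) ws) len))
      no-piece = piece-fits (cell (k ∸ c) r d (false ∷ s)) (no-length , All.tabulate no-fits) cells₀
      yes-piece = piece-fits (cell c (r ∸ 1) d (true ∷ s)) (refl , All.tabulate yes-fits) (proj₁ (proj₂ no-piece))
      new = piece (cell c (r ∸ 1) d (true ∷ s)) (piece (cell (k ∸ c) r d (false ∷ s)) x)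
      perm : concat (proj₁ yes-piece) ↭ ws ++ concat wss
      perm = begin
        concat (proj₁ yes-piece) ≡⟨ proj₂ (proj₂ yes-piece) ⟩
        filterᵇ (a v) ws ++ concat (proj₁ no-piece) ≡⟨ cong (filterᵇ (a v) ws ++_) (proj₂ (proj₂ no-piece)) ⟩
        filterᵇ (a v) ws ++ filterᵇ (not ∘ a v) ws ++ concat wss₀ ≡⟨ ++-assoc (filterᵇ (a v) ws) _ _ ⟨
        (filterᵇ (a v) ws ++ filterᵇ (not ∘ a v) ws) ++ concat wss₀ ↭⟨ ++⁺ (filterᵇ-↭ (a v) ws) perm₀ ⟩
        ws ++ concat wss ∎
        where open PermutationReasoning
      -- A single neighbour w in the cell certifies the residual and the triangle test for all the
      -- others.
      admissible! : admissible (deg v) (map (a v) ps) (map deg ps) (cell k r d s) (c + left) c ≡ true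
      admissible! with filterᵇ (a v) ws in eq
      ... | [] = refl
      ... | w ∷ ws′ with ∈-filterᵇ⁻ (a v) {xs = ws} (subst (w ∈_) (sym eq) (here refl))
      ...   | w∈ , vw with resid w∈ vw | All.lookup fits w∈
      ...     | r′ , refl | fit p refl refl = ∧-intro (≤ᵇ-complete (m≤m+n (suc (length ws′)) left)) (triangle-free v w ps vw)
      c≤k : c ≤ k
      c≤k = subst (c ≤_) (trans (count-not (a v) ws) len) (m≤m+n c _)
      membership : new ∈ splits (deg v) (map (a v) ps) (map deg ps) (cell k r d s ∷ cs) (c + left)
      membership = ∈-concatMap⁺ _ (Any.map (λ { refl → subst (new ∈_) (sym (if-true admissible!))
          (∈-map⁺ _ (subst (λ l → x ∈ splits _ _ _ cs l) (sym (m+n∸m≡n c left)) x∈)) })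
        (∈-upTo⁺ (s≤s c≤k)))

  data Rows : List V → List (List Bool) → Set where
    []  : Rows [] []
    _∷_ : ∀ {v ps s rows} → map (a v) ps ≡ s → Rows ps rows → Rows (v ∷ ps) (s ∷ rows)

  -- The search sees only sizes of cells, so the vertex it processes can be taken to be the head of
  -- the list that realises the first cell.
  search-sound : ∀ f {cs ps rows wss} → Rows ps rows → Cells ps cs wss → ps ++ concat wss ↭ vs → length (concat wss) ≡ f →
    Σ (List (List Bool)) λ leaf → leaf ∈ search f cs (map deg ps) rows × Σ (List V) λ qs → Rows qs leaf × qs ↭ vs
  search-sound zero {ps = ps} {rows} {wss} rs cells perm len with concat wss | len
  ... | [] | _ = rows , here refl , ps , rs , subst (_↭ vs) (++-identityʳ ps) perm
  search-sound (suc f) {[]} rs [] perm ()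
  search-sound (suc f) {cell zero r d s ∷ cs} {wss = [] ∷ wss} rs (_ ∷ cells) perm len = search-sound (suc f) rs cells perm len
  search-sound (suc f) {cell (suc k) r d s ∷ cs} {ps} {rows} {(v ∷ ws) ∷ wss} rs ((len′ , fit p refl refl ∷ fits) ∷ cells) perm len =
      let leaf , leaf∈ , result = ih in
      leaf , ∈-concatMap⁺ (λ x → search f x (deg v ∷ map deg ps) (map (a v) ps ∷ rows))
        (Any.map (λ { refl → leaf∈ }) (subst (λ l → proj₁ step ∈ splits (deg v) (map (a v) ps) (map deg ps) (piece (cell k r (deg v) (map (a v) ps)) cs) l) resid (proj₁ (proj₂ step)))) , result
    where
    rest : Σ _ λ wss′ → Cells ps (piece (cell k r (deg v) (map (a v) ps)) cs) wss′ × concat wss′ ≡ ws ++ concat wss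
    rest = piece-fits (cell k r (deg v) (map (a v) ps)) {ws} (suc-injective len′ , fits) cells
    others = concat (proj₁ rest)
    perm′ : ps ++ v ∷ others ↭ vs
    perm′ = subst (λ xs → ps ++ v ∷ xs ↭ vs) (sym (proj₂ (proj₂ rest))) perm
    degree-split : ∀ w → deg w ≡ count (a w) ps + count (a w) (v ∷ others)
    degree-split w = trans (sym (count-↭ (a w) perm′)) (count-++ (a w) ps (v ∷ others))
    -- The degree of v minus its processed neighbours is what the remaining vertices must supply, so
    -- r is the right total to distribute.
    resid : count (a v) others ≡ r
    resid = sym (+-cancelʳ-≡ (count (a v) ps) r _ (begin
      r + count (a v) ps ≡⟨ cong (r +_) (count-map id (a v) ps) ⟨
      r + count id (map (a v) ps) ≡⟨ p ⟩
      deg v ≡⟨ degree-split v ⟩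
      count (a v) ps + count (a v) (v ∷ others) ≡⟨ cong (count (a v) ps +_) (count-skip (a v) v others (adj-irrefl G v)) ⟩
      count (a v) ps + count (a v) others ≡⟨ +-comm (count (a v) ps) _ ⟩
      count (a v) others + count (a v) ps ∎))
      where open ≡-Reasoning
    bound : ∀ {w} → w ∈ others → count (a w) (v ∷ ps) ≤ deg w
    bound {w} _ = subst₂ _≤_ refl (sym (trans (sym (count-↭ (a w) perm′)) (count-↭ (a w) (shift v ps others))))
      (subst (count (a w) (v ∷ ps) ≤_) (sym (count-++ (a w) (v ∷ ps) others)) (m≤m+n _ _))
    step = splits-sound v ps (proj₁ (proj₂ rest)) bound
    ih : Σ (List (List Bool)) λ leaf → leaf ∈ search f (proj₁ step) (deg v ∷ map deg ps) (map (a v) ps ∷ rows) ×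
      Σ (List V) λ qs → Rows qs leaf × qs ↭ vs
    ih = let wss′ , cells′ , perm₁ = proj₂ (proj₂ step) in
      search-sound f (refl ∷ rs) cells′
        (↭-trans (↭-sym (shift v ps (concat wss′))) (↭-trans (++⁺ˡ ps (prep v perm₁)) perm′))
        (trans (↭-length perm₁) (trans (cong length (proj₂ (proj₂ rest))) (suc-injective len)))

  initial-sound : ∀ ds ws → (∀ {w} → w ∈ ws → deg w ∈ ds) →
    Σ (List Cell) λ x → x ∈ initial ds (length ws) (∑ ws deg) × Σ (List (List V)) λ wss → Cells [] x wss × concat wss ↭ ws
  initial-sound [] [] _ = [] , here refl , [] , [] , ↭-refl
  initial-sound [] (w ∷ ws) d∈ = case d∈ (here refl) of λ ()
  initial-sound (d ∷ ds) ws d∈ with initial-sound ds others others∈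
    where
    others = filterᵇ (λ w → not (deg w ≡ᵇ d)) ws
    others∈ : ∀ {w} → w ∈ others → deg w ∈ ds
    others∈ {w} w∈ with ∈-filterᵇ⁻ (λ w → not (deg w ≡ᵇ d)) {xs = ws} w∈
    ... | w∈ws , q with d∈ w∈ws
    ...   | there r = r
    ...   | here refl = ⊥-elim (true≢false (≡ᵇ-refl (deg w)) (not-true q))
  ... | x , x∈ , wss , cells , perm =
        piece (cell c d d []) x
      , ∈-concatMap⁺ _ (Any.map (λ { refl → subst (piece (cell c d d []) x ∈_) (sym (if-true (≤ᵇ-complete cd≤)))
          (∈-map⁺ _ (subst₂ (λ k S → x ∈ initial ds k S) others-length others-sum x∈)) }) (∈-upTo⁺ (s≤s c≤)))
      , proj₁ first , proj₁ (proj₂ first)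
      , ↭-trans (↭-reflexive (proj₂ (proj₂ first))) (↭-trans (++⁺ˡ _ perm) (filterᵇ-↭ is-d ws))
    where
    is-d : V → Bool
    is-d w = deg w ≡ᵇ d
    others = filterᵇ (not ∘ is-d) ws
    c = count is-d ws
    fits : ∀ {w} → w ∈ filterᵇ is-d ws → Fit [] d d [] w
    fits {w} w∈ = fit (+-identityʳ d) (≡ᵇ-sound _ _ (proj₂ (∈-filterᵇ⁻ is-d {xs = ws} w∈))) refl
    first = piece-fits (cell c d d []) (refl , All.tabulate fits) cells
    c≤ : c ≤ length ws
    c≤ = subst (c ≤_) (count-not is-d ws) (m≤m+n c _)
    others-length : length others ≡ length ws ∸ c
    others-length = trans (sym (m+n∸m≡n c _)) (cong (_∸ c) (count-not is-d ws))
    sum-split : ∑ ws deg ≡ c * d + ∑ others deg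
    sum-split = trans (sym (∑-↭ deg (filterᵇ-↭ is-d ws))) (trans (∑-++ (filterᵇ is-d ws) others deg)
      (cong (_+ ∑ others deg) (∑-const (filterᵇ is-d ws) deg d (λ w∈ → Fit.deg≡ (fits w∈)))))
    cd≤ : c * d ≤ ∑ ws deg
    cd≤ = subst (c * d ≤_) (sym sum-split) (m≤m+n (c * d) _)
    others-sum : ∑ others deg ≡ ∑ ws deg ∸ c * d
    others-sum = trans (sym (m+n∸m≡n (c * d) _)) (cong (_∸ c * d) (sym sum-split))

  lookup-row : ∀ {ps rows} → Rows ps rows → Fin (length rows) → V
  lookup-row {p ∷ ps} (_ ∷ rs) zero = p
  lookup-row (_ ∷ rs) (suc i) = lookup-row rs i

  position : ∀ {ps rows v} → Rows ps rows → v ∈ ps → Fin (length rows)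
  position (_ ∷ rs) (here _) = zero
  position (_ ∷ rs) (there v∈) = suc (position rs v∈)

  lookup-position : ∀ {ps rows v} (rs : Rows ps rows) (v∈ : v ∈ ps) → lookup-row rs (position rs v∈) ≡ v
  lookup-position (_ ∷ rs) (here refl) = refl
  lookup-position (_ ∷ rs) (there v∈) = lookup-position rs v∈

  lookup-∈ : ∀ {ps rows} (rs : Rows ps rows) i → lookup-row rs i ∈ ps
  lookup-∈ (_ ∷ rs) zero = here refl
  lookup-∈ (_ ∷ rs) (suc i) = there (lookup-∈ rs i)

  lookup-injective : ∀ {ps rows} (rs : Rows ps rows) → Unique ps → ∀ i j → lookup-row rs i ≡ lookup-row rs j → i ≡ j
  lookup-injective (_ ∷ rs) _ zero zero _ = refl
  lookup-injective (_ ∷ rs) (p∉ ∷ u) zero (suc j) e = contradiction e (All.lookup p∉ (lookup-∈ rs j))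
  lookup-injective (_ ∷ rs) (p∉ ∷ u) (suc i) zero e = contradiction (sym e) (All.lookup p∉ (lookup-∈ rs i))
  lookup-injective (_ ∷ rs) (_ ∷ u) (suc i) (suc j) e = cong suc (lookup-injective rs u i j e)

  nth-row : ∀ {ps rows} v (rs : Rows ps rows) j → nth (map (a v) ps) (toℕ j) ≡ a v (lookup-row rs j)
  nth-row v (_ ∷ rs) zero = refl
  nth-row v (_ ∷ rs) (suc j) = nth-row v rs j

  entry-row : ∀ {ps rows} (rs : Rows ps rows) i j → (toℕ i <ᵇ toℕ j) ≡ true →
    entry rows (toℕ i) (toℕ j) ≡ a (lookup-row rs i) (lookup-row rs j)
  entry-row {v ∷ _} (refl ∷ rs) zero (suc j) _ = nth-row v rs j
  entry-row (_ ∷ rs) (suc i) (suc j) l = entry-row rs i j l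

  adj-row : ∀ {ps rows} (rs : Rows ps rows) i j → adj (rowsGraph rows) i j ≡ a (lookup-row rs i) (lookup-row rs j)
  adj-row rs i j with toℕ i <ᵇ toℕ j in l | toℕ j <ᵇ toℕ i in m
  ... | true | _ = entry-row rs i j l
  ... | false | true = trans (entry-row rs j i m) (adj-sym G (lookup-row rs j) (lookup-row rs i))
  ... | false | false rewrite toℕ-injective (≤-antisym (≮ᵇ⇒≥ (toℕ j) (toℕ i) m) (≮ᵇ⇒≥ (toℕ i) (toℕ j) l)) = sym (adj-irrefl G (lookup-row rs j))

  rows-≅ : ∀ {ps rows} → Rows ps rows → ps ↭ vs → rowsGraph rows ≅ G
  rows-≅ {ps} rs perm = record
    { to = lookup-row rs
    ; from = λ v → position rs (∈ps v)
    ; from∘to = λ i → lookup-injective rs unique _ i (lookup-position rs (∈ps (lookup-row rs i)))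
    ; to∘from = λ v → lookup-position rs (∈ps v)
    ; adj-pres = λ i j → sym (adj-row rs i j) }
    where
    ∈ps : ∀ v → v ∈ ps
    ∈ps v = ∈-resp-↭ (↭-sym perm) (∈-allFin v)
    unique : Unique ps
    unique = Unique-resp-↭ (↭⇒↭ₛ (↭-sym perm)) (Unique.allFin⁺ _)
      where open import Data.List.Relation.Binary.Permutation.Setoid.Properties (setoid V) using (Unique-resp-↭)

  enumerate : ∀ ds → (∀ v → deg v ∈ ds) →
    Σ (List (List Bool)) λ leaf → leaf ∈ leaves ds (n G) (∣E∣ G) × rowsGraph leaf ≅ G
  enumerate ds d∈ with initial-sound ds vs (λ _ → d∈ _)
  ... | cs , cs∈ , wss , cells , perm with search-sound (length vs) [] cells perm (↭-length perm)
  ...   | leaf , leaf∈ , qs , rs , perm′ = leaf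
      , subst₂ (λ k S → leaf ∈ concatMap (λ cs → search k cs [] []) (initial ds k S))
          (length-tabulate id) (degree-sum G)
          (∈-concatMap⁺ (λ cs → search (length vs) cs [] []) (Any.map (λ { refl → leaf∈ }) cs∈))
      , rows-≅ rs perm′

-- Certificate checking

-- Vertex maps are given by numerals: the image of vertex i is digit i, counted from the right.
digit : ℕ → ℕ → ℕ
digit p zero = p % 10
digit p (suc i) = digit (p / 10) i

-- Digits out of range go to the last element. This is harmless because every map read from a
-- numeral is tested before it is used.
clamp : ∀ {k} → ℕ → Fin (suc k)
clamp {zero} _ = zero
clamp {suc k} zero = zero
clamp {suc k} (suc i) = suc (clamp i)

_⇔ᵇ_ : Bool → Bool → Bool
true ⇔ᵇ b = b
false ⇔ᵇ b = not b

⇔ᵇ⇒≡ : ∀ a b → (a ⇔ᵇ b) ≡ true → a ≡ b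
⇔ᵇ⇒≡ true true _ = refl
⇔ᵇ⇒≡ false false _ = refl

find : {A : Set} → (A → Bool) → A → List A → A
find p d [] = d
find p d (x ∷ xs) = if p x then x else find p d xs

module _ (G H : Graph) (to : Fin (n G) → Fin (n H)) (from : Fin (n H) → Fin (n G)) where

  private
    to? from? adj? : Bool
    to? = all (λ x → from (to x) == x) (allFin (n G))
    from? = all (λ y → to (from y) == y) (allFin (n H))
    adj? = all (λ x → all (λ y → adj H (to x) (to y) ⇔ᵇ adj G x y) (allFin (n G))) (allFin (n G))

  inverse? : Bool
  inverse? = to? ∧ (from? ∧ adj?)

  inverse?-sound : inverse? ≡ true → G ≅ H
  inverse?-sound e with ∧-true {to?} e
  ... | e₁ , e₂₃ with ∧-true {from?} e₂₃
  ...   | e₂ , e₃ = record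
    { to = to ; from = from
    ; from∘to = λ x → ==⇒≡ _ _ (all-allFin (λ x → from (to x) == x) e₁ x)
    ; to∘from = λ y → ==⇒≡ _ _ (all-allFin (λ y → to (from y) == y) e₂ y)
    ; adj-pres = λ x y → ⇔ᵇ⇒≡ _ _ (all-allFin (λ y → adj H (to x) (to y) ⇔ᵇ adj G x y)
        (all-allFin (λ x → all (λ y → adj H (to x) (to y) ⇔ᵇ adj G x y) (allFin (n G))) e₃ x) y) }

module _ {j k : ℕ} (p : ℕ) where

  digit-map : Fin (suc j) → Fin (suc k)
  digit-map x = clamp (digit p (toℕ x))

  -- The default `zero` cannot let a wrong map pass: `inverse?` tests both composites.
  digit-inverse : Fin (suc k) → Fin (suc j)
  digit-inverse y = find (λ x → digit-map x == y) zero (allFin (suc j))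

iso? : Graph → Graph → ℕ → Bool
iso? G@(mkGraph (suc _) _) H@(mkGraph (suc _) _) p = inverse? G H (digit-map p) (digit-inverse p)
iso? _ _ _ = false

iso?-sound : ∀ G H p → iso? G H p ≡ true → G ≅ H
iso?-sound G@(mkGraph (suc _) _) H@(mkGraph (suc _) _) p e = inverse?-sound G H (digit-map p) (digit-inverse p) e

_∈ᵇ_ : ∀ {k} → Fin k → List (Fin k) → Bool
x ∈ᵇ xs = any (x ==_) xs

∈ᵇ⇒∈ : ∀ {k} (x : Fin k) xs → (x ∈ᵇ xs) ≡ true → x ∈ xs
∈ᵇ⇒∈ x xs e with any-witness (x ==_) xs e
... | y , y∈ , xy rewrite ==⇒≡ x y xy = y∈

-- Deciding connectivity and internal 4-connectivity

module Checks (G : Graph) where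

  private
    V = Fin (n G)
    vs = allFin (n G)

  -- Each vertex is enlisted at most once, so fuel n exhausts a component; too little fuel could
  -- only make a test fail. `extend` names the new vertices, which occur twice, so that their
  -- evaluation is shared.
  explore : ℕ → (V → Bool) → List V → List V → List V
  extend : ℕ → (V → Bool) → List V → List V → List V → List V
  explore (suc f) P (x ∷ todo) seen = extend f P todo seen (filterᵇ (λ y → P y ∧ (not (y ∈ᵇ seen) ∧ adj G x y)) vs)
  explore _ P _ seen = seen
  extend f P todo seen new = explore f P (new ++ todo) (new ++ seen)

  connected? : (V → Bool) → Bool
  connected? P = from-root (filterᵇ P vs)
    where
    covered : List V → List V → Bool
    covered ws seen = all (_∈ᵇ seen) ws
    from-root : List V → Bool
    from-root [] = true
    from-root (r ∷ ws) = covered (r ∷ ws) (explore (n G) P (r ∷ []) (r ∷ []))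

  module _ (P : V → Bool) where

    Reached : V → V → Set
    Reached r = Walk G (λ v → P v ≡ true) r

    explore-sound : ∀ f {r} todo seen → All (Reached r) todo → All (Reached r) seen → All (Reached r) (explore f P todo seen)
    explore-sound zero todo seen _ s = s
    explore-sound (suc f) [] seen _ s = s
    explore-sound (suc f) {r} (x ∷ todo) seen (w ∷ t) s = explore-sound f _ _ (All.++⁺ fresh t) (All.++⁺ fresh s)
      where
      fresh : All (Reached r) (filterᵇ (λ y → P y ∧ (not (y ∈ᵇ seen) ∧ adj G x y)) vs)
      fresh = All.tabulate (λ {y} y∈ → let e = proj₂ (∈-filterᵇ⁻ (λ y → P y ∧ (not (y ∈ᵇ seen) ∧ adj G x y)) {xs = vs} y∈) in
        walk-snoc w (proj₁ (∧-true e)) (proj₂ (∧-true {not (y ∈ᵇ seen)} (proj₂ (∧-true {P y} e)))))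

    connected?-sound : connected? P ≡ true → ConnectedOn G (λ v → P v ≡ true)
    connected?-sound e x y px py with filterᵇ P vs in eq
    ... | [] = case subst (x ∈_) eq (∈-filterᵇ⁺ P (∈-allFin x) px) of λ ()
    ... | r ∷ ws = walk-reverse (reached x px) ⋈ reached y py
      where
      pr : P r ≡ true
      pr = proj₂ (∈-filterᵇ⁻ P {xs = vs} (subst (r ∈_) (sym eq) (here refl)))
      reached : ∀ x → P x ≡ true → Reached r x
      reached x px = All.lookup (explore-sound (n G) _ _ ([] pr ∷ []) ([] pr ∷ []))
        (∈ᵇ⇒∈ x _ (all-lookup _ e (subst (x ∈_) eq (∈-filterᵇ⁺ P (∈-allFin x) px))))

  private
    Edge = V × V

  boundary : List Edge → List Edge → ℕ
  boundary xs ys = count (λ v → any (incident v) xs ∧ any (incident v) ys) vs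

  triangle : V → V → V → Edge → Bool
  triangle a b c e = ((incident a e ∧ incident b e) ∨ (incident b e ∧ incident c e)) ∨ (incident a e ∧ incident c e)

  exactly : (Edge → Bool) → List Edge → List Edge → Bool
  exactly p xs ys = all p xs ∧ all (not ∘ p) ys

  triangle? star? side? : List Edge → List Edge → Bool
  triangle? xs ys = any (λ a → any (λ b → adj G a b ∧ any (λ c → (adj G b c ∧ adj G a c) ∧ exactly (triangle a b c) xs ys) vs) vs) vs
  star? xs ys = any (λ v → exactly (incident v) xs ys ∧ (degree G v ≡ᵇ 3)) vs
  side? xs ys = (length xs <ᵇ 3) ∨ ((length ys <ᵇ length xs) ∨ ((4 ≤ᵇ boundary xs ys) ∨
    ((boundary xs ys ≡ᵇ 3) ∧ (star? xs ys ∨ triangle? xs ys))))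

  -- Once four vertices meet both sides, no extension of the partial bipartition can violate the condition.
  sides? : List Edge → List Edge → List Edge → Bool
  sides? xs ys [] = side? xs ys
  sides? xs ys (e ∷ es) = (4 ≤ᵇ boundary xs ys) ∨ (sides? (xs ++ e ∷ []) ys es ∧ sides? xs (ys ++ e ∷ []) es)

  three-connected? : Bool
  three-connected? = (4 ≤ᵇ n G) ∧ all (λ a → all (λ b → (toℕ b <ᵇ toℕ a) ∨ connected? (λ v → not (v == a) ∧ not (v == b))) vs) vs

  i4c? : Bool
  i4c? = three-connected? ∧ sides? [] [] (edges G)



  private
    Triangle Star : List Edge → List Edge → Set
    Triangle xs ys = Σ V λ a → Σ V λ b → Σ V λ c →
      adj G a b ≡ true × adj G b c ≡ true × adj G a c ≡ true × exactly (triangle a b c) xs ys ≡ true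
    Star xs ys = Σ V λ v → degree G v ≡ 3 × exactly (incident v) xs ys ≡ true

    record Side (xs ys : List Edge) : Set where
      constructor side
      field
        internal : 3 ≤ length xs → length xs ≤ length ys →
          3 ≤ boundary xs ys × (boundary xs ys ≡ 3 → Triangle xs ys ⊎ Star xs ys)

  star?-sound : ∀ xs ys → star? xs ys ≡ true → Star xs ys
  star?-sound xs ys e with any-witness (λ v → exactly (incident v) xs ys ∧ (degree G v ≡ᵇ 3)) vs e
  ... | v , _ , p with ∧-true {exactly (incident v) xs ys} p
  ...   | q , d = v , ≡ᵇ-sound _ 3 d , q

  triangle?-sound : ∀ xs ys → triangle? xs ys ≡ true → Triangle xs ys
  triangle?-sound xs ys e with any-witness (λ a → any (λ b → adj G a b ∧ any (λ c → (adj G b c ∧ adj G a c) ∧ exactly (triangle a b c) xs ys) vs) vs) vs e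
  ... | a , _ , p with any-witness (λ b → adj G a b ∧ any (λ c → (adj G b c ∧ adj G a c) ∧ exactly (triangle a b c) xs ys) vs) vs p
  ...   | b , _ , q with ∧-true {adj G a b} q
  ...     | ab , r with any-witness (λ c → (adj G b c ∧ adj G a c) ∧ exactly (triangle a b c) xs ys) vs r
  ...       | c , _ , s with ∧-true {adj G b c ∧ adj G a c} s
  ...         | t , u with ∧-true {adj G b c} t
  ...           | bc , ac = a , b , c , ab , bc , ac , u

  many-side : ∀ xs ys → 4 ≤ boundary xs ys → Side xs ys
  many-side xs ys 4≤b = side λ _ _ → ≤-trans (n≤1+n 3) 4≤b , λ e → ⊥-elim (<-irrefl (sym e) 4≤b)

  side?-sound : ∀ xs ys → side? xs ys ≡ true → Side xs ys
  side?-sound xs ys e with length xs <ᵇ 3 in e₁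
  ... | true = side λ 3≤ _ → ⊥-elim (<⇒≱ (<ᵇ-sound _ 3 e₁) 3≤)
  ... | false with length ys <ᵇ length xs in e₂
  ...   | true = side λ _ x≤y → ⊥-elim (<⇒≱ (<ᵇ-sound _ _ e₂) x≤y)
  ...   | false with 4 ≤ᵇ boundary xs ys in e₃
  ...     | true = many-side xs ys (≤ᵇ-sound 4 _ e₃)
  ...     | false with ∧-true {boundary xs ys ≡ᵇ 3} e
  ...       | b , st = side λ _ _ → ≤-reflexive (sym (≡ᵇ-sound _ 3 b)) , λ _ → small
    where
    small : Triangle xs ys ⊎ Star xs ys
    small with star? xs ys in s
    ... | true = inj₂ (star?-sound xs ys s)
    ... | false = inj₁ (triangle?-sound xs ys st)

  boundary-mono : ∀ xs ys xs′ ys′ → boundary xs ys ≤ boundary (xs ++ xs′) (ys ++ ys′)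
  boundary-mono xs ys xs′ ys′ = count-mono vs λ v e →
    let p , q = ∧-true {any (incident v) xs} e in ∧-intro (any-++ˡ (incident v) xs xs′ p) (any-++ˡ (incident v) ys ys′ q)

  module _ (X : Edge → Bool) where

    private
      ins outs : List Edge → List Edge
      ins = filterᵇ X
      outs = filterᵇ (not ∘ X)

    -- Follows the branch that X prescribes. New edges are appended at the end, so that the two
    -- lists remain the filters of the processed prefix.
    sides?-sound : ∀ done es → sides? (ins done) (outs done) es ≡ true → Side (ins (done ++ es)) (outs (done ++ es))
    sides?-sound done [] e rewrite ++-identityʳ done = side?-sound _ _ e
    sides?-sound done (x ∷ es) e with 4 ≤ᵇ boundary (ins done) (outs done) in b
    ... | true rewrite filterᵇ-++ X done (x ∷ es) | filterᵇ-++ (not ∘ X) done (x ∷ es) =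
          many-side _ _ (≤-trans (≤ᵇ-sound 4 _ b) (boundary-mono (ins done) (outs done) _ _))
    ... | false with ∧-true {sides? (ins done ++ x ∷ []) (outs done) es} e
    ...   | e₁ , e₂ = subst (λ l → Side (ins l) (outs l)) (++-assoc done (x ∷ []) es)
              (sides?-sound (done ++ x ∷ []) es (next (X x) refl))
      where
      ins-false : X x ≡ false → ins (done ++ x ∷ []) ≡ ins done
      ins-false p rewrite filterᵇ-++ X done (x ∷ []) | p = ++-identityʳ _
      ins-true : X x ≡ true → ins (done ++ x ∷ []) ≡ ins done ++ x ∷ []
      ins-true p rewrite filterᵇ-++ X done (x ∷ []) | p = refl
      outs-true : X x ≡ true → outs (done ++ x ∷ []) ≡ outs done
      outs-true p rewrite filterᵇ-++ (not ∘ X) done (x ∷ []) | p = ++-identityʳ _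
      outs-false : X x ≡ false → outs (done ++ x ∷ []) ≡ outs done ++ x ∷ []
      outs-false p rewrite filterᵇ-++ (not ∘ X) done (x ∷ []) | p = refl
      next : ∀ b → X x ≡ b → sides? (ins (done ++ x ∷ [])) (outs (done ++ x ∷ [])) es ≡ true
      next true p = subst₂ (λ xs ys → sides? xs ys es ≡ true) (sym (ins-true p)) (sym (outs-true p)) e₁
      next false p = subst₂ (λ xs ys → sides? xs ys es ≡ true) (sym (ins-false p)) (sym (outs-false p)) e₂

    exactly-sound : ∀ p → exactly p (ins (edges G)) (outs (edges G)) ≡ true → All (λ e → X e ≡ p e) (edges G)
    exactly-sound p e = All.tabulate λ {x} x∈ → pointwise x x∈ (X x) refl
      where
      pointwise : ∀ x → x ∈ edges G → ∀ b → X x ≡ b → X x ≡ p x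
      pointwise x x∈ true q = trans q (sym (all-lookup p (proj₁ (∧-true e)) (∈-filterᵇ⁺ X x∈ q)))
      pointwise x x∈ false q = trans q (sym (not-true (all-lookup (not ∘ p) (proj₂ (∧-true {all p (ins (edges G))} e))
        (∈-filterᵇ⁺ (not ∘ X) x∈ (cong not q)))))

  three-connected?-sound : three-connected? ≡ true → ThreeConnected G
  three-connected?-sound e with ∧-true {4 ≤ᵇ n G} e
  ... | 4≤ , c = ≤ᵇ-sound 4 _ 4≤ , connected
    where
    P : V → V → V → Bool
    P a b v = not (v == a) ∧ not (v == b)
    ordered : ∀ a b → (toℕ b <ᵇ toℕ a) ≡ false → ConnectedOn G (λ v → ¬ v ≡ a × ¬ v ≡ b)
    ordered a b l x y (x≢a , x≢b) (y≢a , y≢b) =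
      walk-map (λ {v} p → let p₁ , p₂ = ∧-true {not (v == a)} p in out p₁ , out p₂)
        (connected?-sound (P a b) ok x y (∧-intro (inn x≢a) (inn x≢b)) (∧-intro (inn y≢a) (inn y≢b)))
      where
      ok : connected? (P a b) ≡ true
      ok = subst (λ q → q ∨ connected? (P a b) ≡ true) l
        (all-allFin (λ b → (toℕ b <ᵇ toℕ a) ∨ connected? (P a b)) (all-allFin (λ a → all (λ b → (toℕ b <ᵇ toℕ a) ∨ connected? (P a b)) vs) c a) b)
      out : ∀ {v u : V} → not (v == u) ≡ true → ¬ v ≡ u
      out {v} p refl = true≢false (==-refl v) (not-true p)
      inn : ∀ {v u : V} → ¬ v ≡ u → not (v == u) ≡ true
      inn {v} {u} v≢u with v == u in q
      ... | true = contradiction (==⇒≡ v u q) v≢u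
      ... | false = refl
    -- Only pairs with a ≤ b are tested; the opposite order deletes the same vertices.
    connected : ∀ a b → ConnectedOn G (λ v → ¬ v ≡ a × ¬ v ≡ b)
    connected a b x y px py with toℕ b <ᵇ toℕ a in l
    ... | false = ordered a b l x y px py
    ... | true with toℕ a <ᵇ toℕ b in m
    ...   | true = ⊥-elim (lt-asym (toℕ a) (toℕ b) m l)
    ...   | false = walk-map swap (ordered b a m x y (swap px) (swap py))

  i4c?-sound : i4c? ≡ true → Internally4Connected G
  i4c?-sound e with ∧-true {three-connected?} e
  ... | e₁ , e₂ = three-connected?-sound e₁ , λ X 3≤X X≤Y →
        let xs = filterᵇ (uncurry X) (edges G)
            ys = filterᵇ (not ∘ uncurry X) (edges G)
            V≡ : ∣VXY∣ G X ≡ boundary xs ys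
            V≡ = count-cong vs (λ v → cong₂ _∧_ (any-filterᵇ (uncurry X) (incident v) (edges G))
                   (any-filterᵇ (not ∘ uncurry X) (incident v) (edges G)))
            3≤b , small = Side.internal (sides?-sound (uncurry X) [] (edges G) e₂) 3≤X X≤Y
        in subst (3 ≤_) (sym V≡) 3≤b , λ V≡3 → case small (trans (sym V≡) V≡3) of λ
          { (inj₁ (a , b , c , ab , bc , ac , p)) → inj₁ (a , b , c , ab , bc , ac , exactly-sound (uncurry X) _ p)
          ; (inj₂ (v , d , p)) → inj₂ (v , d , exactly-sound (uncurry X) _ p) }

-- Excluding minors

record SpanningModel (G H : Graph) : Set where
  field
    φ : Fin (n G) → Fin (n H)
    onto : ∀ u → Σ (Fin (n G)) λ x → φ x ≡ u
    connected : ∀ u → ConnectedOn G (λ x → φ x ≡ u)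
    joined : ∀ u v → adj H u v ≡ true → Σ (Fin (n G)) λ x → Σ (Fin (n G)) λ y → φ x ≡ u × φ y ≡ v × adj G x y ≡ true

module _ {G H : Graph} (G-connected : ∀ x y → Walk G (λ v → true ≡ true) x y) (u₀ : Fin (n H)) where

  open Checks G

  private
    V = Fin (n G)
    vs = allFin (n G)

  free : (V → Maybe (Fin (n H))) → ℕ
  free φ = count (is-nothing ∘ φ) vs

  -- The first step of the walk into a branch set is an edge along which a free vertex can be
  -- absorbed.
  crossing : (φ : V → Maybe (Fin (n H))) → ∀ {x y u P} → Walk G P x y → φ x ≡ nothing → φ y ≡ just u →
    Σ V λ p → Σ V λ q → Σ (Fin (n H)) λ v → φ p ≡ nothing × φ q ≡ just v × adj G p q ≡ true
  crossing φ ([] _) e f = case trans (sym e) f of λ ()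
  crossing φ (_∷_ {y = z} (_ , xz) w) e f with φ z in φz
  ... | just v = _ , z , v , e , φz , xz
  ... | nothing = crossing φ w φz f

  -- Absorbing the unused vertices into branch sets lets the search below ignore vertex deletions.
  absorb : (φ : V → Maybe (Fin (n H))) → V → Fin (n H) → V → Maybe (Fin (n H))
  absorb φ p v z = if p == z then just v else φ z

  module Absorb (φ : V → Maybe (Fin (n H))) {p q : V} {v : Fin (n H)}
    (φp : φ p ≡ nothing) (φq : φ q ≡ just v) (pq : adj G p q ≡ true) where

    φ′ = absorb φ p v

    φ′p : φ′ p ≡ just v
    φ′p rewrite ==-refl p = refl

    keep : ∀ {z u} → φ z ≡ just u → φ′ z ≡ just u
    keep {z} e with p == z in pz
    ... | false = e
    ... | true rewrite sym (==⇒≡ p z pz) = case trans (sym φp) e of λ ()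

    unkeep : ∀ {z u} → φ′ z ≡ just u → (p ≡ z × v ≡ u) ⊎ φ z ≡ just u
    unkeep {z} e with p == z in pz
    ... | false = inj₂ e
    ... | true = inj₁ (==⇒≡ p z pz , just-injective e)

    fewer : free φ′ < free φ
    fewer = count-< sub (∈-allFin p) (cong is-nothing φp) (cong is-nothing φ′p)
      where
      sub : ∀ z → is-nothing (φ′ z) ≡ true → is-nothing (φ z) ≡ true
      sub z e with p == z in pz
      ... | false = e

    connected′ : (∀ u → ConnectedOn G (λ x → φ x ≡ just u)) → ∀ u → ConnectedOn G (λ x → φ′ x ≡ just u)
    connected′ c u x y px py with anchor x px | anchor y py
      where
      -- The new vertex p reaches the old part of its branch set through q.
      anchor : ∀ x → φ′ x ≡ just u → Σ V λ z → φ z ≡ just u × Walk G (λ x → φ′ x ≡ just u) x z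
      anchor x px with unkeep px
      ... | inj₂ e = x , e , [] px
      ... | inj₁ (refl , refl) = q , φq , (φ′p , pq) ∷ [] (keep φq)
    ... | x′ , ex , wx | y′ , ey , wy = (wx ⋈ walk-map keep (c u x′ y′ ex ey)) ⋈ walk-reverse wy

  -- Induction on the number of free vertices. The branch set of `u₀` is nonempty, and connectedness
  -- of G yields an edge from a free vertex to a used one.
  spanning-model : HasMinor G H → SpanningModel G H
  spanning-model (φ , onto , conn , joined) = go (free φ) φ ≤-refl onto conn joined
    where
    go : ∀ k (φ : V → Maybe (Fin (n H))) → free φ ≤ k →
      (∀ u → Σ V λ x → φ x ≡ just u) → (∀ u → ConnectedOn G (λ x → φ x ≡ just u)) →
      (∀ u v → adj H u v ≡ true → Σ V λ x → Σ V λ y → φ x ≡ just u × φ y ≡ just v × adj G x y ≡ true) →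
      SpanningModel G H
    go k φ bound onto conn joined with any (is-nothing ∘ φ) vs in e
    go zero φ bound onto conn joined | true with any-witness (is-nothing ∘ φ) vs e
    ... | p , p∈ , fp = ⊥-elim (<⇒≱ (count-< {p = is-nothing ∘ φ} {q = λ _ → false} (λ _ ()) p∈ fp refl) (≤-trans bound z≤n))
    go (suc k) φ bound onto conn joined | true with any-witness (is-nothing ∘ φ) vs e
    ... | x , _ , fx with φ x in φx | onto u₀
    ...   | nothing | y , φy with crossing φ (G-connected x y) φx φy
    ...     | p , q , v , φp , φq , pq = go k φ′ (≤-pred (≤-trans fewer bound))
                (λ u → let x , e = onto u in x , keep e) (connected′ conn)
                (λ u v uv → let x , y , ex , ey , xy = joined u v uv in x , y , keep ex , keep ey , xy)
      where open Absorb φ {p} {q} {v} φp φq pq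
    go k φ bound onto conn joined | false = record
      { φ = ψ
      ; onto = λ u → let x , e = onto u in x , unjust e
      ; connected = λ u x y ex ey → walk-map unjust (conn u x y (total′ ex) (total′ ey))
      ; joined = λ u v uv → let x , y , ex , ey , xy = joined u v uv in x , y , unjust ex , unjust ey , xy }
      where
      total : ∀ x → Σ (Fin (n H)) λ u → φ x ≡ just u
      total x with φ x in φx
      ... | just u = u , refl
      ... | nothing = ⊥-elim (true≢false (any-allFin (is-nothing ∘ φ) x (cong is-nothing φx)) e)
      ψ : V → Fin (n H)
      ψ x = proj₁ (total x)
      unjust : ∀ {x u} → φ x ≡ just u → ψ x ≡ u
      unjust {x} e = just-injective (trans (sym (proj₂ (total x))) e)
      total′ : ∀ {x u} → ψ x ≡ u → φ x ≡ just u
      total′ {x} refl = proj₂ (total x)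

-- A spanning model is determined by the set of edges of G inside branch sets. The search decides this edge by
-- edge; a labelling sends each vertex to the representative (root) of its class so far.
module MinorSearch (G H : Graph) (κ : ℕ) where

  private
    V = Fin (n G)
    vs = allFin (n G)
    W = Fin (n H)
    Edge = V × V

  roots : Vec V (n G) → List V
  roots lab = filterᵇ (λ z → lookup lab z == z) vs

  quotient : List Edge → Vec V (n G) → List Edge
  quotient all-edges lab = filterᵇ (λ e → not (proj₁ e == proj₂ e))
    (map (λ e → lookup lab (proj₁ e) , lookup lab (proj₂ e)) all-edges)

  linked : List Edge → V → V → Bool
  linked qs r s = any (λ e → ((proj₁ e == r) ∧ (proj₂ e == s)) ∨ ((proj₁ e == s) ∧ (proj₂ e == r))) qs

  -- Roots that are not linked represent non-adjacent vertices of H; κ is a lower bound for the number of common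
  -- neighbours of such vertices (possibly equal, so that κ also bounds the minimum degree).
  few-common : List Edge → List V → Bool
  few-common qs rs = any (λ r → any (λ s → not (linked qs r s) ∧ (count (λ t → linked qs r t ∧ linked qs s t) rs <ᵇ κ)) rs) rs

  compatible : List Edge → V → W → V × W → Bool
  compatible qs r u (s , v) = not (u == v) ∧ (not (adj H u v) ∨ linked qs r s)

  place : List Edge → List V → List (V × W) → Bool
  place qs [] done = true
  place qs (r ∷ rs) done = any (λ u → all (compatible qs r u) done ∧ place qs rs ((r , u) ∷ done)) (allFin (n H))

  embeds : List Edge → List V → Bool
  embeds qs rs = not (few-common qs rs) ∧ place qs rs []

  -- The edge list is an argument so that it is evaluated once, not at every leaf.
  module _ (all-edges : List Edge) where

    -- An edge between two classes is left alone or contracted. The first choice is not recorded, so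
    -- later merges may still join its ends; this adds cases but misses no model. Merging never
    -- creates classes, so having fewer of them than H has vertices is a dead end.
    contract : List Edge → Vec V (n G) → Bool
    contract-edge : List Edge → Vec V (n G) → V → V → Bool
    merge-into : List Edge → Vec V (n G) → Bool
    contract [] lab = embeds (quotient all-edges lab) (roots lab)
    contract ((x , y) ∷ es) lab = contract-edge es lab (lookup lab x) (lookup lab y)
    contract-edge es lab a b =
      if a == b then contract es lab
      else (contract es lab ∨ merge-into es (Vec.map (λ l → if a == l then b else l) lab))
    merge-into es lab = (n H ≤ᵇ length (roots lab)) ∧ contract es lab

    contract-all : Bool
    contract-all = contract all-edges (Vec.allFin (n G))

  common-neighbours? : Bool
  common-neighbours? = all (λ u → all (λ v → adj H u v ∨ (κ ≤ᵇ count (λ w → adj H u w ∧ adj H v w) (allFin (n H)))) (allFin (n H))) (allFin (n H))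

  module Sound (M : SpanningModel G H) (κ-ok : common-neighbours? ≡ true) where

    open SpanningModel M

    -- The classes refine the branch sets; by `done`, an edge inside a branch set is already
    -- contracted or still pending in `es`.
    record Labelling (es : List Edge) (lab : Vec V (n G)) : Set where
      field
        same : ∀ z → φ (lookup lab z) ≡ φ z
        idem : ∀ z → lookup lab (lookup lab z) ≡ lookup lab z
        done : ∀ {x y} → (x , y) ∈ edges G → φ x ≡ φ y → lookup lab x ≡ lookup lab y ⊎ (x , y) ∈ es

    module _ {es lab} (L : Labelling es lab) where
      open Labelling L

      root-∈ : ∀ z → lookup lab z ∈ roots lab
      root-∈ z = ∈-filterᵇ⁺ (λ z → lookup lab z == z) (∈-allFin _) (trans (cong (_== lookup lab z) (idem z)) (==-refl (lookup lab z)))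

      enough-roots : n H ≤ length (roots lab)
      enough-roots = subst₂ _≤_ (length-tabulate id) (length-map φ (roots lab))
        (Unique-⊆-length (Unique.allFin⁺ (n H)) λ {u} _ →
          let x , e = onto u in subst (_∈ map φ (roots lab)) (trans (same x) e) (∈-map⁺ φ (root-∈ x)))

    module Leaf {lab} (L : Labelling [] lab) where
      open Labelling L

      rs = roots lab
      qs = quotient (edges G) lab

      neighbour-label : ∀ x y → adj G x y ≡ true → φ x ≡ φ y → lookup lab x ≡ lookup lab y
      neighbour-label x y xy e with edge-∈ G x y xy
      ... | inj₁ e∈ = case done e∈ e of λ { (inj₁ p) → p }
      ... | inj₂ e∈ = case done e∈ (sym e) of λ { (inj₁ p) → sym p }

      -- Branch sets are connected and no edge is pending, so labels are constant on them. Hence the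
      -- classes at a leaf are exactly the branch sets.
      same-label : ∀ {x y u} → Walk G (λ z → φ z ≡ u) x y → lookup lab x ≡ lookup lab y
      same-label ([] _) = refl
      same-label (_∷_ {x} {y} (p , xy) w) =
        trans (neighbour-label x y xy (trans p (sym (walk-start w)))) (same-label w)

      root : ∀ {r} → r ∈ rs → lookup lab r ≡ r
      root r∈ = ==⇒≡ _ _ (proj₂ (∈-filterᵇ⁻ (λ z → lookup lab z == z) {xs = vs} r∈))

      label-of : ∀ {x r} → r ∈ rs → φ x ≡ φ r → lookup lab x ≡ r
      label-of {x} {r} r∈ e = trans (same-label (connected (φ r) x r e refl)) (root r∈)

      φ-injective : ∀ {r s} → r ∈ rs → s ∈ rs → φ r ≡ φ s → r ≡ s
      φ-injective r∈ s∈ e = trans (sym (root r∈)) (label-of s∈ e)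

      linked-roots : ∀ {r s} → r ∈ rs → s ∈ rs → adj H (φ r) (φ s) ≡ true → linked qs r s ≡ true
      linked-roots {r} {s} r∈ s∈ rs-adj with joined (φ r) (φ s) rs-adj
      ... | x , y , ex , ey , xy = by-edge (edge-∈ G x y xy)
        where
        lx = label-of r∈ ex
        ly = label-of s∈ ey
        r≢s : (r == s) ≡ false
        r≢s with r == s in p
        ... | false = refl
        ... | true = ⊥-elim (adj⇒≢ H {φ r} {φ s} rs-adj (cong φ (==⇒≡ r s p)))
        s≢r : (s == r) ≡ false
        s≢r with s == r in p
        ... | false = refl
        ... | true = ⊥-elim (adj⇒≢ H {φ r} {φ s} rs-adj (cong φ (sym (==⇒≡ s r p))))
        labels : V × V → V × V
        labels e = lookup lab (proj₁ e) , lookup lab (proj₂ e)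
        proper : V × V → Bool
        proper e = not (proj₁ e == proj₂ e)
        by-edge : (x , y) ∈ edges G ⊎ (y , x) ∈ edges G → linked qs r s ≡ true
        by-edge (inj₁ e∈) = any-true _ {x = r , s}
          (∈-filterᵇ⁺ proper (subst₂ (λ a b → (a , b) ∈ map labels (edges G)) lx ly (∈-map⁺ labels e∈)) (cong not r≢s))
          (cong (_∨ ((r == s) ∧ (s == r))) (∧-intro (==-refl r) (==-refl s)))
        by-edge (inj₂ e∈) = any-true _ {x = s , r}
          (∈-filterᵇ⁺ proper (subst₂ (λ a b → (a , b) ∈ map labels (edges G)) ly lx (∈-map⁺ labels e∈)) (cong not s≢r))
          (trans (cong (((s == r) ∧ (r == s)) ∨_) (∧-intro (==-refl s) (==-refl r))) (∨-zeroʳ _))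

      root-of : ∀ u → Σ V λ t → t ∈ rs × φ t ≡ u
      root-of u = let x , e = onto u in lookup lab x , root-∈ L x , trans (same x) e

      -- Unlinked roots have non-adjacent images. Each common neighbour of these images is itself
      -- the image of a root linked to both.
      common : ∀ {r s} → r ∈ rs → s ∈ rs → linked qs r s ≡ false → κ ≤ count (λ t → linked qs r t ∧ linked qs s t) rs
      common {r} {s} r∈ s∈ unlinked = ≤-trans κ≤ (subst (length ws ≤_) (length-map φ ts)
          (Unique-⊆-length (Unique.filter⁺ (T? ∘ common-H) (Unique.allFin⁺ (n H))) sub))
        where
        common-H : W → Bool
        common-H w = adj H (φ r) w ∧ adj H (φ s) w
        common-G : V → Bool
        common-G t = linked qs r t ∧ linked qs s t
        ws = filterᵇ common-H (allFin (n H))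
        ts = filterᵇ common-G rs
        non-adjacent : adj H (φ r) (φ s) ≡ false
        non-adjacent with adj H (φ r) (φ s) in e
        ... | false = refl
        ... | true = ⊥-elim (true≢false (linked-roots r∈ s∈ e) unlinked)
        κ≤ : κ ≤ length ws
        κ≤ = ≤ᵇ⇒≤ κ _ (subst T (sym (subst (λ b → b ∨ (κ ≤ᵇ length ws) ≡ true) non-adjacent
          (all-allFin (λ v → adj H (φ r) v ∨ (κ ≤ᵇ count (λ w → adj H (φ r) w ∧ adj H v w) (allFin (n H))))
            (all-allFin (λ u → all (λ v → adj H u v ∨ (κ ≤ᵇ count (λ w → adj H u w ∧ adj H v w) (allFin (n H)))) (allFin (n H))) κ-ok (φ r))
            (φ s)))) _)
        sub : ∀ {w} → w ∈ ws → w ∈ map φ ts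
        sub {w} w∈ with root-of w | ∧-true {adj H (φ r) w} (proj₂ (∈-filterᵇ⁻ common-H {xs = allFin (n H)} w∈))
        ... | t , t∈ , refl | rt , st = ∈-map⁺ φ (∈-filterᵇ⁺ common-G t∈ (∧-intro (linked-roots r∈ t∈ rt) (linked-roots s∈ t∈ st)))

      not-few : few-common qs rs ≡ false
      not-few with few-common qs rs in e
      ... | false = refl
      ... | true with any-witness (λ r → any (λ s → not (linked qs r s) ∧ (count (λ t → linked qs r t ∧ linked qs s t) rs <ᵇ κ)) rs) rs e
      ...   | r , r∈ , p with any-witness (λ s → not (linked qs r s) ∧ (count (λ t → linked qs r t ∧ linked qs s t) rs <ᵇ κ)) rs p
      ...     | s , s∈ , q with ∧-true {not (linked qs r s)} q
      ...       | unl , lt = ⊥-elim (<⇒≱ (<ᵇ-sound _ κ lt) (common r∈ s∈ (not-true unl)))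

      -- The choice u = φ r passes every test. The last part of the invariant keeps placed roots
      -- apart from those still to come, as injectivity requires.
      placed : ∀ ts done → Unique ts → (∀ {r} → r ∈ ts → r ∈ rs) →
        All (λ e → proj₁ e ∈ rs × proj₂ e ≡ φ (proj₁ e) × ¬ proj₁ e ∈ ts) done → place qs ts done ≡ true
      placed [] done _ _ _ = refl
      placed (r ∷ ts) done (r∉ ∷ u) sub placed-done = any-allFin _ (φ r) (∧-intro (all-true done placed-done)
          (placed ts ((r , φ r) ∷ done) u (sub ∘ there) ((sub (here refl) , refl , λ r∈ → All.lookup r∉ r∈ refl)
            ∷ All.map (λ { (a , b , c) → a , b , c ∘ there }) placed-done)))
        where
        compatible-true : ∀ {e} → proj₁ e ∈ rs × proj₂ e ≡ φ (proj₁ e) × ¬ proj₁ e ∈ r ∷ ts → compatible qs r (φ r) e ≡ true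
        compatible-true {s , v} (s∈ , refl , s∉) = ∧-intro distinct still-linked
          where
          distinct : not (φ r == φ s) ≡ true
          distinct with φ r == φ s in e
          ... | false = refl
          ... | true = ⊥-elim (s∉ (here (sym (φ-injective (sub (here refl)) s∈ (==⇒≡ _ _ e)))))
          still-linked : not (adj H (φ r) (φ s)) ∨ linked qs r s ≡ true
          still-linked with adj H (φ r) (φ s) in e
          ... | false = refl
          ... | true = linked-roots (sub (here refl)) s∈ e
        all-true : ∀ es → All (λ e → proj₁ e ∈ rs × proj₂ e ≡ φ (proj₁ e) × ¬ proj₁ e ∈ r ∷ ts) es → all (compatible qs r (φ r)) es ≡ true
        all-true [] [] = refl
        all-true (e ∷ es) (p ∷ ps) = ∧-intro (compatible-true p) (all-true es ps)

      leaf-sound : embeds qs rs ≡ true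
      leaf-sound = ∧-intro (cong not not-few)
        (placed rs [] (Unique.filter⁺ (λ z → T? (lookup lab z == z)) (Unique.allFin⁺ (n G))) id [])

    -- The model dictates the choices: contract an edge between two classes exactly when both ends
    -- lie in one branch set.
    contract-sound : ∀ es lab → Labelling es lab → contract (edges G) es lab ≡ true
    contract-sound [] lab L = Leaf.leaf-sound L
    contract-sound ((x , y) ∷ es) lab L = edge
      where
      open Labelling L
      a = lookup lab x
      b = lookup lab y
      settle : (φ x ≡ φ y → a ≡ b) → Labelling es lab
      settle settled = record { same = same ; idem = idem ; done = λ e∈ e → case done e∈ e of λ
        { (inj₁ p) → inj₁ p ; (inj₂ (here refl)) → inj₁ (settled e) ; (inj₂ (there p)) → inj₂ p } }
      edge : contract-edge (edges G) es lab a b ≡ true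
      edge with a == b in ab
      ... | true = contract-sound es lab (settle (λ _ → ==⇒≡ a b ab))
      ... | false with φ x ≟ φ y
      ...   | no ≢ = cong (_∨ merge-into (edges G) es (Vec.map (λ l → if a == l then b else l) lab)) (contract-sound es lab (settle (λ e → contradiction e ≢)))
      ...   | yes φ≡ = trans (cong (contract (edges G) es lab ∨_) (∧-intro (≤ᵇ-complete (enough-roots merged)) (contract-sound es _ merged))) (∨-zeroʳ _)
        where
        g : V → V
        g l = if a == l then b else l
        at : ∀ z → lookup (Vec.map g lab) z ≡ g (lookup lab z)
        at z = lookup-map z g lab
        g-φ : ∀ l → φ (g l) ≡ φ l
        g-φ l with a == l in al
        ... | false = refl
        ... | true rewrite sym (==⇒≡ a l al) = trans (same y) (trans (sym φ≡) (sym (same x)))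
        g-b : g b ≡ b
        g-b rewrite ab = refl
        g-a : g a ≡ b
        g-a rewrite ==-refl a = refl
        -- A merged vertex now has label b, a root by `idem y`; the other labels are unchanged.
        g-idem : ∀ z → g (lookup lab (g (lookup lab z))) ≡ g (lookup lab z)
        g-idem z with a == lookup lab z in az
        ... | true = trans (cong g (idem y)) g-b
        ... | false rewrite idem z | az = refl
        merged : Labelling es (Vec.map g lab)
        merged = record
          { same = λ z → trans (cong φ (at z)) (trans (g-φ _) (same z))
          ; idem = λ z → trans (at _) (trans (cong (λ l → g (lookup lab l)) (at z)) (trans (g-idem z) (sym (at z))))
          ; done = λ {u} {v} e∈ e → case done e∈ e of λ
              { (inj₁ p) → inj₁ (trans (at u) (trans (cong g p) (sym (at v))))
              ; (inj₂ (here refl)) → inj₁ (trans (at u) (trans g-a (trans (sym g-b) (sym (at v)))))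
              ; (inj₂ (there p)) → inj₂ p } }

    start : Labelling (edges G) (Vec.allFin (n G))
    start = record
      { same = λ z → cong φ (lookup-allFin z)
      ; idem = λ z → lookup-allFin _
      ; done = λ e∈ _ → inj₂ e∈ }

  no-minor? : Bool
  no-minor? = Checks.connected? G (λ _ → true) ∧ (common-neighbours? ∧ not (contract-all (edges G)))

  no-minor?-sound : Fin (n H) → no-minor? ≡ true → ¬ HasMinor G H
  no-minor?-sound u₀ e minor with ∧-true {Checks.connected? G (λ _ → true)} e
  ... | c , e′ with ∧-true {common-neighbours?} e′
  ...   | κ-ok , e″ = true≢false (contract-sound (edges G) _ start) (not-true e″)
    where
    open Sound (spanning-model (λ x y → Checks.connected?-sound G (λ _ → true) c x y refl refl) u₀ minor) κ-ok

-- Exhibiting minors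

walk-≅ : ∀ {G H} (φ : G ≅ H) {P : Fin (n H) → Set} {x y} →
  Walk G (λ v → P (_≅_.to φ v)) x y → Walk H P (_≅_.to φ x) (_≅_.to φ y)
walk-≅ φ ([] p) = [] p
walk-≅ φ (_∷_ {x} {y} (p , xy) w) = (p , trans (_≅_.adj-pres φ x y) xy) ∷ walk-≅ φ w

minor-≅ˡ : ∀ {G G′ H} → G ≅ G′ → HasMinor G H → HasMinor G′ H
minor-≅ˡ {G} {G′} {H} iso (φ , onto , connected , joined) = φ ∘ from
    , (λ u → let x , e = onto u in to x , back e)
    , (λ u x y ex ey → subst₂ (Walk G′ _) (to∘from x) (to∘from y)
        (walk-≅ iso (walk-map back (connected u (from x) (from y) ex ey))))
    , λ u v uv → let x , y , ex , ey , xy = joined u v uv in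
        to x , to y , back ex , back ey , trans (adj-pres x y) xy
  where
  open _≅_ iso
  back : ∀ {x u} → φ x ≡ just u → φ (from (to x)) ≡ just u
  back {x} e = trans (cong φ (from∘to x)) e

minor-≅ʳ : ∀ {G H H′} → H ≅ H′ → HasMinor G H → HasMinor G H′
minor-≅ʳ {G} {H} {H′} iso (φ , onto , connected , joined) = Maybe.map to ∘ φ
    , (λ u → let x , e = onto (from u) in x , fwd e)
    , (λ u x y ex ey → walk-map fwd (connected (from u) x y (bwd ex) (bwd ey)))
    , λ u v uv → let x , y , ex , ey , xy = joined (from u) (from v) (trans (sym (adj-pres (from u) (from v)))
                       (trans (cong₂ (adj H′) (to∘from u) (to∘from v)) uv))
                 in x , y , fwd ex , fwd ey , xy
  where
  open _≅_ iso
  fwd : ∀ {x u} → φ x ≡ just (from u) → Maybe.map to (φ x) ≡ just u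
  fwd {u = u} e = trans (cong (Maybe.map to) e) (cong just (to∘from u))
  bwd : ∀ {x u} → Maybe.map to (φ x) ≡ just u → φ x ≡ just (from u)
  bwd {x} e with φ x
  ... | just w = cong just (trans (sym (from∘to w)) (cong from (just-injective e)))

minor-refl : ∀ G → HasMinor G G
minor-refl G = just , (λ u → u , refl)
    , (λ { u x y ex ey → subst₂ (Walk G _) (sym (just-injective ex)) (sym (just-injective ey)) ([] refl) })
    , λ u v uv → u , v , refl , refl , uv

-- Unlike `clamp`, this sends a number out of range to no branch set at all.
fin? : ∀ {k} → ℕ → Maybe (Fin k)
fin? {zero} _ = nothing
fin? {suc k} zero = just zero
fin? {suc k} (suc i) = Maybe.map suc (fin? i)

is : ∀ {k} → Maybe (Fin k) → Fin k → Bool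
is nothing u = false
is (just v) u = v == u

is-sound : ∀ {k} (m : Maybe (Fin k)) u → is m u ≡ true → m ≡ just u
is-sound (just v) u e = cong just (==⇒≡ v u e)

is-complete : ∀ {k} (m : Maybe (Fin k)) u → m ≡ just u → is m u ≡ true
is-complete _ u refl = ==-refl u

module _ (G H : Graph) where

  -- Digit 0 marks an unused vertex, digit u + 1 the branch set of u.
  branch : ℕ → Fin (n G) → Maybe (Fin (n H))
  branch p x = image (digit p (toℕ x))
    where
    image : ℕ → Maybe (Fin (n H))
    image zero = nothing
    image (suc u) = fin? u

  module _ (φ : Fin (n G) → Maybe (Fin (n H))) where

    private
      meets : Fin (n H) → Fin (n H) → Bool
      meets u v = any (λ x → is (φ x) u ∧ any (λ y → is (φ y) v ∧ adj G x y) (allFin (n G))) (allFin (n G))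

      onto? connected? joined? : Bool
      onto? = all (λ u → any (λ x → is (φ x) u) (allFin (n G))) (allFin (n H))
      connected? = all (λ u → Checks.connected? G (λ x → is (φ x) u)) (allFin (n H))
      joined? = all (λ u → all (λ v → not (adj H u v) ∨ meets u v) (allFin (n H))) (allFin (n H))

    model? : Bool
    model? = onto? ∧ (connected? ∧ joined?)

    model?-sound : model? ≡ true → HasMinor G H
    model?-sound e with ∧-true {onto?} e
    ... | o , e′ with ∧-true {connected?} e′
    ...   | c , j = φ
        , (λ u → let x , _ , p = any-witness _ (allFin (n G)) (all-allFin (λ u → any (λ x → is (φ x) u) (allFin (n G))) o u)
                 in x , is-sound (φ x) u p)
        , (λ u x y ex ey → walk-map (λ {z} → is-sound (φ z) u)
             (Checks.connected?-sound G (λ x → is (φ x) u) (all-allFin (λ u → Checks.connected? G (λ x → is (φ x) u)) c u) x y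
               (is-complete (φ x) u ex) (is-complete (φ y) u ey)))
        , λ u v uv → meeting u v (all-allFin (λ v → not (adj H u v) ∨ meets u v) (all-allFin (λ u → all (λ v → not (adj H u v) ∨ meets u v) (allFin (n H))) j u) v) uv
      where
      meeting : ∀ u v → not (adj H u v) ∨ meets u v ≡ true → adj H u v ≡ true →
        Σ (Fin (n G)) λ x → Σ (Fin (n G)) λ y → φ x ≡ just u × φ y ≡ just v × adj G x y ≡ true
      meeting u v e uv with any-witness (λ x → is (φ x) u ∧ any (λ y → is (φ y) v ∧ adj G x y) (allFin (n G))) (allFin (n G))
                              (subst (λ b → not b ∨ meets u v ≡ true) uv e)
      ... | x , _ , p with ∧-true {is (φ x) u} p
      ...   | xu , q with any-witness (λ y → is (φ y) v ∧ adj G x y) (allFin (n G)) q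
      ...     | y , _ , r with ∧-true {is (φ y) v} r
      ...       | yv , xy = x , y , is-sound (φ x) u xu , is-sound (φ y) v yv , xy

  hasMinor? : ℕ → Bool
  hasMinor? p = model? (branch p)

  hasMinor : ∀ p → hasMinor? p ≡ true → HasMinor G H
  hasMinor p = model?-sound (branch p)

-- Certificates for the leaves

module _ (H : Graph) where

  -- Digit 1 marks A, digit 2 marks B; an edge is in X when it meets A or lies inside B.
  separation : ℕ → EdgeSet H
  separation w i j = (mark 1 i ∨ mark 1 j) ∨ (mark 2 i ∧ mark 2 j)
    where
    mark : ℕ → Fin (n H) → Bool
    mark d i = digit w (toℕ i) ≡ᵇ d

  separation-sym : ∀ w → Symmetric H (separation w)
  separation-sym w i j = cong₂ _∨_ (∨-comm (digit w (toℕ i) ≡ᵇ 1) _) (∧-comm (digit w (toℕ i) ≡ᵇ 2) _)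

  separated? : ℕ → Bool
  separated? w = (4 ≤ᵇ ∣X∣ H (separation w)) ∧ ((4 ≤ᵇ ∣Y∣ H (separation w)) ∧ (∣VXY∣ H (separation w) <ᵇ 4))

  separated-sound : ∀ w → separated? w ≡ true → ¬ Robust H
  separated-sound w e robust with ∧-true {4 ≤ᵇ ∣X∣ H (separation w)} e
  ... | x , e′ with ∧-true {4 ≤ᵇ ∣Y∣ H (separation w)} e′
  ...   | y , v = <⇒≱ (<ᵇ-sound _ 4 v)
          (robust (separation w) (separation-sym w) (≤ᵇ-sound 4 _ x) (≤ᵇ-sound 4 _ y))

-- A leaf of the enumeration is either refuted by a separation or isomorphic to a graph of the list, given by its
-- index and the digits of an isomorphism.
data Certificate : Set where
  separated : ℕ → Certificate
  copy : ℕ → ℕ → Certificate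

module Classify (graphs : List Graph) where

  nth-graph : ℕ → Maybe (Σ Graph (_∈ graphs))
  nth-graph = go graphs id
    where
    go : ∀ Gs → (∀ {G} → G ∈ Gs → G ∈ graphs) → ℕ → Maybe (Σ Graph (_∈ graphs))
    go [] _ _ = nothing
    go (G ∷ Gs) sub zero = just (G , sub (here refl))
    go (G ∷ Gs) sub (suc k) = go Gs (sub ∘ there) k

  certified? : List (List Bool) → Certificate → Bool
  certified? rows (separated w) = separated? (rowsGraph rows) w
  certified? rows (copy k p) = matches (nth-graph k)
    where
    matches : Maybe (Σ Graph (_∈ graphs)) → Bool
    matches nothing = false
    matches (just (H , _)) = iso? (rowsGraph rows) H p

  certified-sound : ∀ rows c → certified? rows c ≡ true → Robust (rowsGraph rows) → Σ Graph λ H → H ∈ graphs × rowsGraph rows ≅ H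
  certified-sound rows (separated w) e robust = ⊥-elim (separated-sound (rowsGraph rows) w e robust)
  certified-sound rows (copy k p) e robust with nth-graph k
  ... | just (H , H∈) = H , H∈ , iso?-sound (rowsGraph rows) H p e

  -- Leaves and certificates are matched by position, so the order of the enumeration matters.
  all-certified? : List (List (List Bool)) → List Certificate → Bool
  all-certified? [] _ = true
  all-certified? (_ ∷ _) [] = false
  all-certified? (l ∷ ls) (c ∷ cs) = certified? l c ∧ all-certified? ls cs

  all-certified-sound : ∀ ls cs → all-certified? ls cs ≡ true → ∀ {rows} → rows ∈ ls → Robust (rowsGraph rows) →
    Σ Graph λ H → H ∈ graphs × rowsGraph rows ≅ H
  all-certified-sound (l ∷ ls) (c ∷ cs) e (here refl) = certified-sound l c (proj₁ (∧-true e))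
  all-certified-sound (l ∷ ls) (c ∷ cs) e (there l∈) = all-certified-sound ls cs (proj₂ (∧-true {certified? l c} e)) l∈

allLeaves : List ℕ → List ℕ → List ℕ → List (List (List Bool))
allLeaves ds ks ms = concatMap (λ k → concatMap (λ m → leaves ds k m) ms) ks

allLeaves-∈ : ∀ {ds ks ms k m rows} → k ∈ ks → m ∈ ms → rows ∈ leaves ds k m → rows ∈ allLeaves ds ks ms
allLeaves-∈ {ds} {ks} {ms} {k} k∈ m∈ r∈ = ∈-concatMap⁺ (λ k → concatMap (λ m → leaves ds k m) ms)
  (Any.map (λ { refl → ∈-concatMap⁺ (λ m → leaves ds k m) (Any.map (λ { refl → r∈ }) m∈) }) k∈)

range : ℕ → ℕ → List ℕ
range lo zero = []
range lo (suc k) = lo ∷ range (suc lo) k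

range-∈ : ∀ lo k {i} → lo ≤ i → i < lo + k → i ∈ range lo k
range-∈ lo zero {i} lo≤i i< = ⊥-elim (<⇒≱ (subst (i <_) (+-identityʳ lo) i<) lo≤i)
range-∈ lo (suc k) {i} lo≤i i< with m≤n⇒m<n∨m≡n lo≤i
... | inj₁ lo<i = there (range-∈ (suc lo) k lo<i (subst (i <_) (+-suc lo k) i<))
... | inj₂ refl = here refl

-- The internally 4-connected graphs with at most 15 edges

V₈ bipyramid prism : Graph
-- The Wagner graph, that is, the Möbius ladder on eight vertices.
V₈ = circulant 8 (1 ∷ 7 ∷ 4 ∷ [])
bipyramid = fromList 7
  ((0 , 1) ∷ (0 , 4) ∷ (0 , 5) ∷ (0 , 6) ∷ (1 , 2) ∷ (1 , 5) ∷ (1 , 6) ∷ (2 , 3) ∷ (2 , 5) ∷ (2 , 6) ∷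
  (3 , 4) ∷ (3 , 5) ∷ (3 , 6) ∷ (4 , 5) ∷ (4 , 6) ∷ [])
prism = fromList 10
  ((0 , 1) ∷ (0 , 4) ∷ (0 , 5) ∷ (1 , 2) ∷ (1 , 6) ∷ (2 , 3) ∷ (2 , 7) ∷ (3 , 4) ∷ (3 , 8) ∷ (4 , 9) ∷
  (5 , 6) ∷ (5 , 9) ∷ (6 , 7) ∷ (7 , 8) ∷ (8 , 9) ∷ [])
-- Some of these are familiar. `G₆` is K₆ and `G₁` is K₆ minus an edge; `G₁₂` is K₄,₄ minus an edge
-- and `G₃` is K₄,₄ minus two disjoint edges; `G₂`, `G₇`, `G₈`, `G₉` arise from K₃,₄ by adding,
-- within the class of four, a path of two edges, a path of three edges, a star or a triangle; `G₂₂`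
-- is the Petersen graph.
G₁ G₂ G₃ G₄ G₅ G₆ G₇ G₈ G₉ G₁₀ G₁₁ G₁₂ G₁₃ G₁₄ G₁₅ G₁₆ G₁₇ G₁₈ G₁₉ G₂₀ G₂₁ G₂₂ G₂₃ G₂₄ : Graph
G₁ = fromList 6
  ((0 , 2) ∷ (0 , 3) ∷ (0 , 4) ∷ (0 , 5) ∷ (1 , 2) ∷ (1 , 3) ∷ (1 , 4) ∷ (1 , 5) ∷ (2 , 3) ∷ (2 , 4) ∷
  (2 , 5) ∷ (3 , 4) ∷ (3 , 5) ∷ (4 , 5) ∷ [])
G₂ = fromList 7
  ((0 , 2) ∷ (0 , 3) ∷ (0 , 4) ∷ (0 , 5) ∷ (0 , 6) ∷ (1 , 4) ∷ (1 , 5) ∷ (1 , 6) ∷ (2 , 4) ∷ (2 , 5) ∷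
  (2 , 6) ∷ (3 , 4) ∷ (3 , 5) ∷ (3 , 6) ∷ [])
G₃ = fromList 8
  ((0 , 4) ∷ (0 , 5) ∷ (0 , 6) ∷ (0 , 7) ∷ (1 , 4) ∷ (1 , 5) ∷ (1 , 6) ∷ (1 , 7) ∷ (2 , 4) ∷ (2 , 6) ∷
  (2 , 7) ∷ (3 , 5) ∷ (3 , 6) ∷ (3 , 7) ∷ [])
G₄ = fromList 8
  ((0 , 3) ∷ (0 , 4) ∷ (0 , 5) ∷ (0 , 6) ∷ (1 , 3) ∷ (1 , 4) ∷ (1 , 5) ∷ (1 , 6) ∷ (2 , 5) ∷ (2 , 6) ∷
  (2 , 7) ∷ (3 , 5) ∷ (3 , 7) ∷ (4 , 7) ∷ [])
G₅ = fromList 9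
  ((0 , 3) ∷ (0 , 4) ∷ (0 , 5) ∷ (0 , 6) ∷ (1 , 4) ∷ (1 , 7) ∷ (1 , 8) ∷ (2 , 4) ∷ (2 , 5) ∷ (2 , 6) ∷
  (3 , 7) ∷ (3 , 8) ∷ (5 , 7) ∷ (6 , 8) ∷ [])
G₆ = fromList 6
  ((0 , 1) ∷ (0 , 2) ∷ (0 , 3) ∷ (0 , 4) ∷ (0 , 5) ∷ (1 , 2) ∷ (1 , 3) ∷ (1 , 4) ∷ (1 , 5) ∷ (2 , 3) ∷
  (2 , 4) ∷ (2 , 5) ∷ (3 , 4) ∷ (3 , 5) ∷ (4 , 5) ∷ [])
G₇ = fromList 7
  ((0 , 1) ∷ (0 , 2) ∷ (0 , 4) ∷ (0 , 5) ∷ (0 , 6) ∷ (1 , 3) ∷ (1 , 4) ∷ (1 , 5) ∷ (1 , 6) ∷ (2 , 4) ∷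
  (2 , 5) ∷ (2 , 6) ∷ (3 , 4) ∷ (3 , 5) ∷ (3 , 6) ∷ [])
G₈ = fromList 7
  ((0 , 1) ∷ (0 , 2) ∷ (0 , 3) ∷ (0 , 4) ∷ (0 , 5) ∷ (0 , 6) ∷ (1 , 4) ∷ (1 , 5) ∷ (1 , 6) ∷ (2 , 4) ∷
  (2 , 5) ∷ (2 , 6) ∷ (3 , 4) ∷ (3 , 5) ∷ (3 , 6) ∷ [])
G₉ = fromList 7
  ((0 , 4) ∷ (0 , 5) ∷ (0 , 6) ∷ (1 , 2) ∷ (1 , 3) ∷ (1 , 4) ∷ (1 , 5) ∷ (1 , 6) ∷ (2 , 3) ∷ (2 , 4) ∷
  (2 , 5) ∷ (2 , 6) ∷ (3 , 4) ∷ (3 , 5) ∷ (3 , 6) ∷ [])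
G₁₀ = fromList 7
  ((0 , 1) ∷ (0 , 2) ∷ (0 , 3) ∷ (0 , 4) ∷ (0 , 5) ∷ (0 , 6) ∷ (1 , 3) ∷ (1 , 4) ∷ (1 , 5) ∷ (2 , 4) ∷
  (2 , 5) ∷ (2 , 6) ∷ (3 , 5) ∷ (3 , 6) ∷ (4 , 6) ∷ [])
G₁₁ = fromList 7
  ((0 , 1) ∷ (0 , 2) ∷ (0 , 3) ∷ (0 , 4) ∷ (0 , 5) ∷ (1 , 3) ∷ (1 , 4) ∷ (1 , 5) ∷ (1 , 6) ∷ (2 , 4) ∷
  (2 , 5) ∷ (2 , 6) ∷ (3 , 5) ∷ (3 , 6) ∷ (4 , 6) ∷ [])
G₁₂ = fromList 8
  ((0 , 2) ∷ (0 , 3) ∷ (0 , 4) ∷ (1 , 5) ∷ (1 , 6) ∷ (1 , 7) ∷ (2 , 5) ∷ (2 , 6) ∷ (2 , 7) ∷ (3 , 5) ∷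
  (3 , 6) ∷ (3 , 7) ∷ (4 , 5) ∷ (4 , 6) ∷ (4 , 7) ∷ [])
G₁₃ = fromList 8
  ((0 , 2) ∷ (0 , 4) ∷ (0 , 5) ∷ (1 , 3) ∷ (1 , 4) ∷ (1 , 5) ∷ (2 , 3) ∷ (2 , 6) ∷ (2 , 7) ∷ (3 , 6) ∷
  (3 , 7) ∷ (4 , 6) ∷ (4 , 7) ∷ (5 , 6) ∷ (5 , 7) ∷ [])
G₁₄ = fromList 8
  ((0 , 1) ∷ (0 , 4) ∷ (0 , 5) ∷ (0 , 6) ∷ (0 , 7) ∷ (1 , 2) ∷ (1 , 3) ∷ (2 , 4) ∷ (2 , 5) ∷ (3 , 6) ∷
  (3 , 7) ∷ (4 , 6) ∷ (4 , 7) ∷ (5 , 6) ∷ (5 , 7) ∷ [])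
G₁₅ = fromList 8
  ((0 , 1) ∷ (0 , 4) ∷ (0 , 5) ∷ (0 , 6) ∷ (0 , 7) ∷ (1 , 2) ∷ (1 , 3) ∷ (2 , 5) ∷ (2 , 6) ∷ (3 , 6) ∷
  (3 , 7) ∷ (4 , 5) ∷ (4 , 6) ∷ (4 , 7) ∷ (5 , 7) ∷ [])
G₁₆ = fromList 8
  ((0 , 1) ∷ (0 , 3) ∷ (0 , 4) ∷ (1 , 5) ∷ (1 , 6) ∷ (2 , 4) ∷ (2 , 5) ∷ (2 , 6) ∷ (2 , 7) ∷ (3 , 5) ∷
  (3 , 6) ∷ (3 , 7) ∷ (4 , 6) ∷ (4 , 7) ∷ (5 , 7) ∷ [])
G₁₇ = fromList 8
  ((0 , 1) ∷ (0 , 4) ∷ (0 , 5) ∷ (1 , 6) ∷ (1 , 7) ∷ (2 , 4) ∷ (2 , 5) ∷ (2 , 6) ∷ (2 , 7) ∷ (3 , 4) ∷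
  (3 , 5) ∷ (3 , 6) ∷ (3 , 7) ∷ (4 , 6) ∷ (5 , 7) ∷ [])
G₁₈ = fromList 9
  ((0 , 2) ∷ (0 , 3) ∷ (0 , 5) ∷ (0 , 6) ∷ (1 , 2) ∷ (1 , 5) ∷ (1 , 6) ∷ (1 , 7) ∷ (2 , 4) ∷ (2 , 8) ∷
  (3 , 7) ∷ (3 , 8) ∷ (4 , 6) ∷ (4 , 7) ∷ (5 , 8) ∷ [])
G₁₉ = fromList 9
  ((0 , 1) ∷ (0 , 2) ∷ (0 , 3) ∷ (0 , 4) ∷ (1 , 2) ∷ (1 , 5) ∷ (1 , 6) ∷ (2 , 7) ∷ (2 , 8) ∷ (3 , 5) ∷
  (3 , 7) ∷ (4 , 6) ∷ (4 , 8) ∷ (5 , 8) ∷ (6 , 7) ∷ [])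
G₂₀ = fromList 9
  ((0 , 1) ∷ (0 , 2) ∷ (0 , 3) ∷ (0 , 4) ∷ (1 , 2) ∷ (1 , 5) ∷ (1 , 6) ∷ (2 , 7) ∷ (2 , 8) ∷ (3 , 7) ∷
  (3 , 8) ∷ (4 , 5) ∷ (4 , 6) ∷ (5 , 7) ∷ (6 , 8) ∷ [])
G₂₁ = fromList 9
  ((0 , 2) ∷ (0 , 4) ∷ (0 , 5) ∷ (0 , 6) ∷ (1 , 2) ∷ (1 , 4) ∷ (1 , 5) ∷ (1 , 6) ∷ (2 , 7) ∷ (2 , 8) ∷
  (3 , 4) ∷ (3 , 7) ∷ (3 , 8) ∷ (5 , 7) ∷ (6 , 8) ∷ [])
G₂₂ = fromList 10
  ((0 , 1) ∷ (0 , 2) ∷ (0 , 3) ∷ (1 , 4) ∷ (1 , 5) ∷ (2 , 6) ∷ (2 , 7) ∷ (3 , 8) ∷ (3 , 9) ∷ (4 , 6) ∷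
  (4 , 8) ∷ (5 , 7) ∷ (5 , 9) ∷ (6 , 9) ∷ (7 , 8) ∷ [])
G₂₃ = fromList 10
  ((0 , 1) ∷ (0 , 2) ∷ (0 , 3) ∷ (1 , 4) ∷ (1 , 5) ∷ (2 , 6) ∷ (2 , 7) ∷ (3 , 8) ∷ (3 , 9) ∷ (4 , 8) ∷
  (4 , 9) ∷ (5 , 6) ∷ (5 , 7) ∷ (6 , 8) ∷ (7 , 9) ∷ [])
G₂₄ = fromList 10
  ((0 , 1) ∷ (0 , 2) ∷ (0 , 3) ∷ (1 , 5) ∷ (1 , 6) ∷ (2 , 7) ∷ (2 , 8) ∷ (3 , 7) ∷ (3 , 9) ∷ (4 , 6) ∷
  (4 , 7) ∷ (4 , 9) ∷ (5 , 8) ∷ (5 , 9) ∷ (6 , 8) ∷ [])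

graphs : List Graph
graphs =
  K₄ ∷ K₃₃ ∷ K₅ ∷ O ∷ Q₃ ∷ V₈ ∷ H₁ ∷ H₂ ∷ H₃ ∷ G₁ ∷ QML₇ ∷ G₂ ∷ Q₃× ∷ G₃ ∷ G₄ ∷ G₅ ∷ Y₉ ∷ G₆ ∷ G₇ ∷
  bipyramid ∷ G₈ ∷ G₉ ∷ G₁₀ ∷ G₁₁ ∷ G₁₂ ∷ G₁₃ ∷ G₁₄ ∷ G₁₅ ∷ G₁₆ ∷ G₁₇ ∷ G₁₈ ∷ G₁₉ ∷ G₂₀ ∷ G₂₁ ∷ CML₁₀ ∷ G₂₂ ∷
  G₂₃ ∷ G₂₄ ∷ prism ∷ []

certificates : List Certificate
certificates =
  copy 2 43210 ∷ copy 1 254310 ∷ copy 3 543210 ∷ copy 6 413520 ∷ copy 9 543210 ∷ copy 17 543210 ∷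
  separated 1100 ∷ separated 110000 ∷ copy 7 4361250 ∷ copy 7 4631250 ∷ separated 1010000 ∷ copy 7 6431250 ∷
  separated 1100000 ∷ separated 110000 ∷ copy 10 5621430 ∷ separated 1010000 ∷ copy 10 5261430 ∷
  copy 10 5216430 ∷ separated 1100000 ∷ copy 11 632541 ∷ copy 11 365421 ∷ copy 19 6532410 ∷ copy 18 1065432 ∷
  copy 23 1045362 ∷ copy 23 1043562 ∷ copy 23 1053462 ∷ copy 23 1035462 ∷ separated 11000 ∷ copy 21 3216540 ∷
  copy 20 365421 ∷ copy 22 256431 ∷ copy 22 264531 ∷ copy 5 65721430 ∷ copy 5 65271430 ∷ copy 5 62571340 ∷
  copy 4 76534210 ∷ separated 11000 ∷ separated 101000 ∷ separated 110000 ∷ copy 8 27513640 ∷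
  copy 13 17605432 ∷ copy 14 13506472 ∷ copy 14 13504672 ∷ copy 14 31507462 ∷ copy 14 53102764 ∷
  copy 12 62375140 ∷ copy 12 63275410 ∷ copy 12 36274510 ∷ copy 25 57643210 ∷ copy 25 57632410 ∷
  separated 1110000 ∷ copy 24 74326510 ∷ copy 28 63427510 ∷ copy 28 63247510 ∷ copy 28 64237510 ∷
  copy 28 53726410 ∷ copy 28 62437510 ∷ copy 25 37265410 ∷ copy 29 73524610 ∷ copy 29 73526410 ∷
  copy 28 52734610 ∷ copy 25 32765410 ∷ copy 29 75324610 ∷ copy 29 75326410 ∷ copy 28 57324610 ∷
  copy 28 57234610 ∷ copy 25 75432610 ∷ copy 25 75324610 ∷ separated 10110000 ∷ copy 25 73254610 ∷
  copy 29 37546210 ∷ copy 29 37564210 ∷ copy 28 26475310 ∷ copy 28 25746310 ∷ copy 28 75324610 ∷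
  copy 28 75234610 ∷ separated 11010000 ∷ copy 28 27546310 ∷ copy 28 72543610 ∷ separated 11100000 ∷
  separated 110000 ∷ separated 1010000 ∷ separated 1100000 ∷ copy 27 6475132 ∷ copy 26 7546132 ∷
  copy 27 7546132 ∷ copy 27 7456132 ∷ copy 27 4675132 ∷ copy 27 4756132 ∷ separated 11000 ∷
  separated 1100000 ∷ copy 16 73516842 ∷ copy 15 34658721 ∷ copy 15 43652187 ∷ separated 10100000 ∷
  copy 16 75316842 ∷ copy 15 36458721 ∷ copy 15 46352187 ∷ copy 16 75136842 ∷ copy 15 63458271 ∷
  copy 15 64352817 ∷ copy 15 36548721 ∷ copy 15 63548271 ∷ copy 15 65342871 ∷ copy 15 46532187 ∷
  copy 15 64532817 ∷ copy 15 65432871 ∷ separated 11000000 ∷ separated 110000 ∷ separated 110000 ∷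
  separated 110000 ∷ separated 110000 ∷ separated 110000 ∷ separated 110000 ∷ copy 30 120567843 ∷
  copy 30 120657483 ∷ copy 33 120465873 ∷ copy 33 120645873 ∷ copy 33 120654873 ∷ copy 30 210845673 ∷
  copy 30 210486573 ∷ copy 33 210876543 ∷ copy 32 21438765 ∷ copy 31 210875643 ∷ copy 32 120658743 ∷
  copy 32 201873465 ∷ copy 32 21348765 ∷ separated 110000 ∷ separated 1010000 ∷ separated 1100000 ∷
  copy 36 1045239876 ∷ copy 35 5791823640 ∷ copy 36 1450987632 ∷ copy 36 1405983276 ∷ copy 36 1045329876 ∷
  copy 36 9743258106 ∷ copy 37 4679183250 ∷ copy 37 6418795023 ∷ copy 36 9743528106 ∷ copy 37 4697183520 ∷
  copy 37 6481795203 ∷ copy 37 4679813250 ∷ copy 37 4697813520 ∷ copy 36 4198503762 ∷ copy 37 6418975023 ∷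
  copy 37 6481975203 ∷ copy 36 4198053762 ∷ separated 11000000 ∷ copy 37 4769328150 ∷ copy 36 9473815206 ∷
  copy 37 4967351820 ∷ copy 37 4967358120 ∷ copy 37 6148509723 ∷ copy 36 4918370562 ∷ copy 37 6841529703 ∷
  copy 34 7862391540 ∷ copy 37 7423960851 ∷ copy 38 8793264510 ∷ separated 101000000 ∷ copy 37 4796325810 ∷
  copy 37 4976352810 ∷ copy 36 9437810526 ∷ copy 36 4981376052 ∷ copy 37 8562194073 ∷ copy 37 8652149073 ∷
  copy 34 7826391540 ∷ copy 37 7432960851 ∷ copy 38 8739264510 ∷ copy 34 7286319540 ∷ copy 37 7342906851 ∷
  copy 38 8379246510 ∷ separated 111000000 ∷ separated 110000000 ∷ []

-- The second argument of `range` is a length: degrees run from 9 down to 3, since a degree is less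
-- than the order; orders run from 5 to 10 and sizes from 8 to 15.
degrees sizes orders : List ℕ
degrees = reverse (range 3 7)
orders = range 5 6
sizes = range 8 8

certified : Classify.all-certified? graphs (allLeaves degrees orders sizes) certificates ≡ true
certified = refl

-- Classification of the graphs with at most 15 edges

four-vertices : ∀ G → n G ≡ 4 → (∀ v → 3 ≤ degree G v) → G ≅ K₄
four-vertices G@(mkGraph .4 E) refl 3≤ = record
    { to = id ; from = id ; from∘to = λ _ → refl ; to∘from = λ _ → refl ; adj-pres = adj≡ }
  where
  vs = allFin 4
  adj≡ : ∀ x y → adj K₄ x y ≡ adj G x y
  adj≡ x y with x ≟ y
  ... | yes refl = trans (adj-irrefl K₄ x) (sym (adj-irrefl G x))
  ... | no x≢y with adj G x y in xy
  ...   | true = complete x y x≢y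
    where
    complete : ∀ (x y : Fin 4) → ¬ x ≡ y → adj K₄ x y ≡ true
    complete x y x≢y with toℕ x <ᵇ toℕ y in l | toℕ y <ᵇ toℕ x in m
    ... | true | _ = refl
    ... | false | true = refl
    ... | false | false = contradiction (toℕ-injective (≤-antisym (≮ᵇ⇒≥ _ _ m) (≮ᵇ⇒≥ _ _ l))) x≢y
  -- If x and y were distinct and non-adjacent, then x, y and at least three neighbours of x would
  -- make five vertices.
  ...   | false = ⊥-elim (<⇒≱ (+-monoˡ-≤ 1 (+-monoˡ-≤ 1 (3≤ x))) at-most)
    where
    open ≤-Reasoning
    at-most : degree G x + 1 + 1 ≤ 4
    at-most = begin
      degree G x + 1 + 1 ≡⟨ cong₂ _+_ (cong₂ _+_ (degree-∑ G x) (sym (∑-δ x (λ _ → 1)))) (sym (∑-δ y (λ _ → 1))) ⟩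
      ∑ vs (λ w → ⟦ adj G x w ⟧) + ∑ vs (λ w → ⟦ x == w ⟧ * 1) + ∑ vs (λ w → ⟦ y == w ⟧ * 1)
        ≡⟨ cong (_+ ∑ vs (λ w → ⟦ y == w ⟧ * 1)) (∑-+ vs (λ w → ⟦ adj G x w ⟧) (λ w → ⟦ x == w ⟧ * 1)) ⟨
      ∑ vs (λ w → ⟦ adj G x w ⟧ + ⟦ x == w ⟧ * 1) + ∑ vs (λ w → ⟦ y == w ⟧ * 1)
        ≡⟨ ∑-+ vs (λ w → ⟦ adj G x w ⟧ + ⟦ x == w ⟧ * 1) (λ w → ⟦ y == w ⟧ * 1) ⟨
      ∑ vs (λ w → ⟦ adj G x w ⟧ + ⟦ x == w ⟧ * 1 + ⟦ y == w ⟧ * 1) ≤⟨ ∑-mono vs pointwise ⟩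
      4 ∎
      where
      pointwise : ∀ w → ⟦ adj G x w ⟧ + ⟦ x == w ⟧ * 1 + ⟦ y == w ⟧ * 1 ≤ 1
      pointwise w with x == w in xw | y == w in yw
      ... | true | true = contradiction (trans (==⇒≡ x w xw) (sym (==⇒≡ y w yw))) x≢y
      ... | true | false rewrite sym (==⇒≡ x w xw) | adj-irrefl G x = ≤-refl
      ... | false | true rewrite sym (==⇒≡ y w yw) | xy = ≤-refl
      ... | false | false with adj G x w
      ...   | true = ≤-refl
      ...   | false = z≤n

module _ {G : Graph} (three : ThreeConnected G) where

  order-size : n G * 3 ≤ ∣E∣ G + ∣E∣ G
  order-size = subst₂ _≤_ (trans (∑-const (allFin (n G)) (λ _ → 3) 3 (λ _ → refl)) (cong (λ k → k * 3) order))
    (degree-sum G) (∑-mono (allFin (n G)) (minimum-degree G three))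
    where
    order : length (allFin (n G)) ≡ n G
    order = length-tabulate id

  order≤10 : ∣E∣ G ≤ 15 → n G ≤ 10
  order≤10 E≤15 = *-cancelʳ-≤ (n G) 10 3 (≤-trans order-size (+-mono-≤ E≤15 E≤15))

  -- Five vertices of degree at least 3 force 2|E| ≥ 15.
  8≤size : 5 ≤ n G → 8 ≤ ∣E∣ G
  8≤size 5≤n = ≮⇒≥ λ E<8 → <⇒≱ (s≤s (+-mono-≤ (≤-pred E<8) (≤-pred E<8))) (≤-trans (*-monoˡ-≤ 3 5≤n) order-size)

classify : ∀ G → Internally4Connected G → ∣E∣ G ≤ 15 → Σ Graph λ H → H ∈ graphs × G ≅ H
classify G i4c@(three@(4≤n , _) , _) E≤15 with m≤n⇒m<n∨m≡n 4≤n
-- K₄ has only six edges, too few for the argument against cubic vertices in triangles, so order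
-- four is treated apart.
... | inj₂ 4≡n = K₄ , here refl , four-vertices G (sym 4≡n) (minimum-degree G three)
... | inj₁ 5≤n = identify (Enumerate.enumerate G (cubic-no-triangle G robust 8≤E) degrees degree-∈)
  where
  robust : Robust G
  robust = i4c⇒robust G i4c
  8≤E : 8 ≤ ∣E∣ G
  8≤E = 8≤size three 5≤n
  degree-∈ : ∀ v → degree G v ∈ degrees
  degree-∈ v = reverse⁺ (range-∈ 3 7 (minimum-degree G three v) (≤-trans (degree-pred G v) (order≤10 three E≤15)))
  identify : (Σ (List (List Bool)) λ rows → rows ∈ leaves degrees (n G) (∣E∣ G) × rowsGraph rows ≅ G) →
    Σ Graph λ H → H ∈ graphs × G ≅ H
  identify (rows , rows∈ , iso) =
    let H , H∈ , ψ = Classify.all-certified-sound graphs (allLeaves degrees orders sizes) certificates certified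
          (allLeaves-∈ {degrees} {orders} {sizes} (range-∈ 5 6 5≤n (s≤s (order≤10 three E≤15))) (range-∈ 8 8 8≤E (s≤s E≤15)) rows∈)
          (Transport.robust-≅ (≅-sym iso) robust)
    in H , H∈ , ≅-trans (≅-sym iso) ψ

-- Verdicts on the pairs

Conclusion : Graph → Graph → Set
Conclusion G₁ G₂ =
  ((G₁ ≅ K₅ ⊎ G₁ ≅ Q₃ ⊎ G₁ ≅ O ⊎ G₁ ≅ QML₇) × G₂ ≅ K₄)
  ⊎ ((G₁ ≅ H₁ ⊎ G₁ ≅ H₂ ⊎ G₁ ≅ H₃ ⊎ G₁ ≅ QML₇) × G₂ ≅ K₃₃)
  ⊎ ((G₁ ≅ Q₃× ⊎ G₁ ≅ Y₉ ⊎ G₁ ≅ QML₇ ⊎ G₁ ≅ CML₁₀) × G₂ ≅ K₅)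

-- `tight` contradicts the gap hypothesis for G₂ itself. In `via`, the strict inequality makes the
-- G-minor proper and the other one contradicts the gap.
data Verdict₁ (R S : Graph) : Set where
  tight : (∣E∣ R ≤ᵇ ∣E∣ S + 3) ≡ true → Verdict₁ R S
  listed : (∀ {G₁ G₂} → G₁ ≅ R → G₂ ≅ S → Conclusion G₁ G₂) → Verdict₁ R S
  excluded : ¬ HasMinor R S → Verdict₁ R S
  via : ∀ G → Internally4Connected G → HasMinor R G → HasMinor G S →
    ((∣E∣ G <ᵇ ∣E∣ R) ∧ (∣E∣ R ≤ᵇ ∣E∣ G + 3)) ≡ true → Verdict₁ R S

Verdict : Graph → Set
Verdict R = Verdict₁ R K₄ × Verdict₁ R K₃₃ × Verdict₁ R K₅

K₃₃-i4c : Internally4Connected K₃₃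
K₃₃-i4c = Checks.i4c?-sound K₃₃ refl

O-i4c : Internally4Connected O
O-i4c = Checks.i4c?-sound O refl

Q₃-i4c : Internally4Connected Q₃
Q₃-i4c = Checks.i4c?-sound Q₃ refl

V₈-i4c : Internally4Connected V₈
V₈-i4c = Checks.i4c?-sound V₈ refl

H₁-i4c : Internally4Connected H₁
H₁-i4c = Checks.i4c?-sound H₁ refl

H₂-i4c : Internally4Connected H₂
H₂-i4c = Checks.i4c?-sound H₂ refl

H₃-i4c : Internally4Connected H₃
H₃-i4c = Checks.i4c?-sound H₃ refl

Y₉-i4c : Internally4Connected Y₉
Y₉-i4c = Checks.i4c?-sound Y₉ refl

K₃₃≥K₄ : HasMinor K₃₃ K₄
K₃₃≥K₄ = hasMinor K₃₃ K₄ 421321 refl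

O≥K₄ : HasMinor O K₄
O≥K₄ = hasMinor O K₄ 432111 refl

Q₃≥K₄ : HasMinor Q₃ K₄
Q₃≥K₄ = hasMinor Q₃ K₄ 43221111 refl

V₈≥K₄ : HasMinor V₈ K₄
V₈≥K₄ = hasMinor V₈ K₄ 43222111 refl

V₈≥K₃₃ : HasMinor V₈ K₃₃
V₈≥K₃₃ = hasMinor V₈ K₃₃ 63552411 refl

H₁≥K₄ : HasMinor H₁ K₄
H₁≥K₄ = hasMinor H₁ K₄ 432111 refl

H₁≥K₃₃ : HasMinor H₁ K₃₃
H₁≥K₃₃ = hasMinor H₁ K₃₃ 653421 refl

H₁≥K₅ : HasMinor H₁ K₅
H₁≥K₅ = hasMinor H₁ K₅ 543121 refl

H₂≥K₄ : HasMinor H₂ K₄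
H₂≥K₄ = hasMinor H₂ K₄ 4132111 refl

H₂≥K₃₃ : HasMinor H₂ K₃₃
H₂≥K₃₃ = hasMinor H₂ K₃₃ 5635241 refl

H₂≥K₅ : HasMinor H₂ K₅
H₂≥K₅ = hasMinor H₂ K₅ 5243211 refl

H₃≥K₄ : HasMinor H₃ K₄
H₃≥K₄ = hasMinor H₃ K₄ 43221111 refl

H₃≥K₃₃ : HasMinor H₃ K₃₃
H₃≥K₃₃ = hasMinor H₃ K₃₃ 61534211 refl

H₃≥K₅ : HasMinor H₃ K₅
H₃≥K₅ = hasMinor H₃ K₅ 54433211 refl

Y₉≥K₅ : HasMinor Y₉ K₅
Y₉≥K₅ = hasMinor Y₉ K₅ 554433221 refl

-- Behind this and the next three facts is planarity of the bipyramid and the prism. Here κ = 3,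
-- since two vertices on one side of K₃₃ share all three neighbours.
bipyramid-no-K₃₃ : ¬ HasMinor bipyramid K₃₃
bipyramid-no-K₃₃ = MinorSearch.no-minor?-sound bipyramid K₃₃ 3 zero refl

-- In K₅ a vertex is non-adjacent only to itself, so κ = 4 is the minimum degree.
bipyramid-no-K₅ : ¬ HasMinor bipyramid K₅
bipyramid-no-K₅ = MinorSearch.no-minor?-sound bipyramid K₅ 4 zero refl

prism-no-K₃₃ : ¬ HasMinor prism K₃₃
prism-no-K₃₃ = MinorSearch.no-minor?-sound prism K₃₃ 3 zero refl

prism-no-K₅ : ¬ HasMinor prism K₅
prism-no-K₅ = MinorSearch.no-minor?-sound prism K₅ 4 zero refl

-- An intermediate graph with all three minors settles R at once; `H₁`, `H₂` and `H₃` are such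
-- graphs.
via-all : ∀ {R} G → Internally4Connected G → HasMinor G K₄ → HasMinor G K₃₃ → HasMinor G K₅ →
  ∀ p → hasMinor? R G p ≡ true → ((∣E∣ G <ᵇ ∣E∣ R) ∧ (∣E∣ R ≤ᵇ ∣E∣ G + 3)) ≡ true → Verdict R
via-all {R} G i4c a b c p e s = via G i4c m a s , via G i4c m b s , via G i4c m c s
  where m = hasMinor R G p e

via-H₁ : ∀ {R} p → hasMinor? R H₁ p ≡ true → ((∣E∣ H₁ <ᵇ ∣E∣ R) ∧ (∣E∣ R ≤ᵇ ∣E∣ H₁ + 3)) ≡ true → Verdict R
via-H₁ {R} = via-all {R} H₁ H₁-i4c H₁≥K₄ H₁≥K₃₃ H₁≥K₅

via-H₂ : ∀ {R} p → hasMinor? R H₂ p ≡ true → ((∣E∣ H₂ <ᵇ ∣E∣ R) ∧ (∣E∣ R ≤ᵇ ∣E∣ H₂ + 3)) ≡ true → Verdict R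
via-H₂ {R} = via-all {R} H₂ H₂-i4c H₂≥K₄ H₂≥K₃₃ H₂≥K₅

via-H₃ : ∀ {R} p → hasMinor? R H₃ p ≡ true → ((∣E∣ H₃ <ᵇ ∣E∣ R) ∧ (∣E∣ R ≤ᵇ ∣E∣ H₃ + 3)) ≡ true → Verdict R
via-H₃ {R} = via-all {R} H₃ H₃-i4c H₃≥K₄ H₃≥K₃₃ H₃≥K₅

verdicts : All Verdict graphs
verdicts =
  (tight refl , tight refl , tight refl) ∷
  (tight refl , tight refl , tight refl) ∷
  ((listed λ p q → inj₁ (inj₁ p , q)) , tight refl , tight refl) ∷
  ((listed λ p q → inj₁ (inj₂ (inj₂ (inj₁ p)) , q)) , tight refl , tight refl) ∷
  ((listed λ p q → inj₁ (inj₂ (inj₁ p) , q)) , tight refl , tight refl) ∷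
  (via K₃₃ K₃₃-i4c (hasMinor V₈ K₃₃ 63552411 refl) K₃₃≥K₄ refl , tight refl , tight refl) ∷
  (via O O-i4c (hasMinor H₁ O 456321 refl) O≥K₄ refl , (listed λ p q → inj₂ (inj₁ (inj₁ p , q))) , tight refl) ∷
  (via O O-i4c (hasMinor H₂ O 6145321 refl) O≥K₄ refl , (listed λ p q → inj₂ (inj₁ (inj₂ (inj₁ p) , q))) , tight refl) ∷
  (via Q₃ Q₃-i4c (hasMinor H₃ Q₃ 56873421 refl) Q₃≥K₄ refl , (listed λ p q → inj₂ (inj₁ (inj₂ (inj₂ (inj₁ p)) , q))) , tight refl) ∷
  (via-H₁ 526341 refl refl) ∷
  ((listed λ p q → inj₁ (inj₂ (inj₂ (inj₂ p)) , q)) , (listed λ p q → inj₂ (inj₁ (inj₂ (inj₂ (inj₂ p)) , q))) , (listed λ p q → inj₂ (inj₂ (inj₂ (inj₂ (inj₁ p)) , q)))) ∷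
  (via-H₁ 6354152 refl refl) ∷
  (via V₈ V₈-i4c (hasMinor Q₃× V₈ 83267451 refl) V₈≥K₄ refl , via V₈ V₈-i4c (hasMinor Q₃× V₈ 83267451 refl) V₈≥K₃₃ refl , (listed λ p q → inj₂ (inj₂ (inj₁ p , q)))) ∷
  (via-H₂ 53176742 refl refl) ∷
  (via-H₂ 63715342 refl refl) ∷
  (via-H₃ 574286183 refl refl) ∷
  (via V₈ V₈-i4c (hasMinor Y₉ V₈ 784562331 refl) V₈≥K₄ refl , via V₈ V₈-i4c (hasMinor Y₉ V₈ 784562331 refl) V₈≥K₃₃ refl , (listed λ p q → inj₂ (inj₂ (inj₂ (inj₁ p) , q)))) ∷
  (via-H₁ 526341 refl refl) ∷
  (via-H₁ 6354521 refl refl) ∷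
  (via O O-i4c (hasMinor bipyramid O 4356211 refl) O≥K₄ refl , excluded bipyramid-no-K₃₃ , excluded bipyramid-no-K₅) ∷
  (via-H₁ 6354152 refl refl) ∷
  (via-H₁ 6325412 refl refl) ∷
  (via-H₁ 6354152 refl refl) ∷
  (via-H₁ 4563521 refl refl) ∷
  (via-H₁ 63541252 refl refl) ∷
  (via-H₁ 63415252 refl refl) ∷
  (via-H₁ 63415552 refl refl) ∷
  (via-H₁ 56345112 refl refl) ∷
  (via-H₁ 63524152 refl refl) ∷
  (via-H₁ 56324152 refl refl) ∷
  (via-H₂ 657175342 refl refl) ∷
  (via-H₂ 644515372 refl refl) ∷
  (via-H₂ 464551372 refl refl) ∷
  (via-H₂ 671755342 refl refl) ∷
  (via V₈ V₈-i4c (hasMinor CML₁₀ V₈ 8765543211 refl) V₈≥K₄ refl , via V₈ V₈-i4c (hasMinor CML₁₀ V₈ 8765543211 refl) V₈≥K₃₃ refl , (listed λ p q → inj₂ (inj₂ (inj₂ (inj₂ (inj₂ p)) , q)))) ∷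
  -- The Wagner graph has no K₅-minor, so for K₅ the graph `Y₉` takes its place.
  (via V₈ V₈-i4c (hasMinor G₂₂ V₈ 6482735131 refl) V₈≥K₄ refl , via V₈ V₈-i4c (hasMinor G₂₂ V₈ 6482735131 refl) V₈≥K₃₃ refl , via Y₉ Y₉-i4c (hasMinor G₂₂ Y₉ 7593846211 refl) Y₉≥K₅ refl) ∷
  (via-H₃ 7164582383 refl refl) ∷
  (via-H₃ 5718684233 refl refl) ∷
  (via Q₃ Q₃-i4c (hasMinor prism Q₃ 7865534211 refl) Q₃≥K₄ refl , excluded prism-no-K₃₃ , excluded prism-no-K₅) ∷
  []

-- Twelve is the least size that |E(G₂)| + 3 < |E(G₁)| ≤ 15 rules out.
data Small : Graph → Set where
  is-K₄ : Small K₄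
  is-K₃₃ : Small K₃₃
  is-K₅ : Small K₅
  large : ∀ {S} → (12 ≤ᵇ ∣E∣ S) ≡ true → Small S

smalls : All Small graphs
smalls = is-K₄ ∷ is-K₃₃ ∷ is-K₅ ∷ all-large _ refl
  where
  all-large : ∀ Gs → all (λ S → 12 ≤ᵇ ∣E∣ S) Gs ≡ true → All Small Gs
  all-large [] _ = []
  all-large (G ∷ Gs) e = large (proj₁ (∧-true e)) ∷ all-large Gs (proj₂ (∧-true {12 ≤ᵇ ∣E∣ G} e))

theorem1p3 : (G₁ G₂ : Graph) →
    Internally4Connected G₁ → Internally4Connected G₂ →
    ∣E∣ G₁ ≤ 15 →
    HasProperMinor G₁ G₂ →
    (∀ (G : Graph) → Internally4Connected G →
    HasProperMinor G₁ G → HasMinor G G₂ → ∣E∣ G + 3 < ∣E∣ G₁) →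
    (((G₁ ≅ K₅ ⊎ G₁ ≅ Q₃ ⊎ G₁ ≅ O ⊎ G₁ ≅ QML₇) × G₂ ≅ K₄)
    ⊎ ((G₁ ≅ H₁ ⊎ G₁ ≅ H₂ ⊎ G₁ ≅ H₃ ⊎ G₁ ≅ QML₇) × G₂ ≅ K₃₃)
    ⊎ ((G₁ ≅ Q₃× ⊎ G₁ ≅ Y₉ ⊎ G₁ ≅ QML₇ ⊎ G₁ ≅ CML₁₀) × G₂ ≅ K₅))
theorem1p3 G₁ G₂ i4c₁ i4c₂ E≤15 proper@(minor , _) gap =
    -- The bound on |E(G₂)| that the classification asks for comes from `gap₂`.
    conclude (classify G₁ i4c₁ E≤15) (classify G₂ i4c₂ (≤-trans (≤-trans (m≤m+n _ 3) (<⇒≤ gap₂)) E≤15))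
  where
  gap₂ : ∣E∣ G₂ + 3 < ∣E∣ G₁
  gap₂ = gap G₂ i4c₂ proper (minor-refl G₂)
  resolve : ∀ {R S} → G₁ ≅ R → G₂ ≅ S → Verdict₁ R S → Conclusion G₁ G₂
  resolve {R} {S} ψ χ (tight e) = ⊥-elim (<⇒≱ gap₂
    (subst₂ (λ a b → a ≤ b + 3) (sym (Transport.∣E∣-≅ ψ)) (sym (Transport.∣E∣-≅ χ)) (≤ᵇ-sound (∣E∣ R) _ e)))
  resolve ψ χ (listed conclusion) = conclusion ψ χ
  resolve ψ χ (excluded no-minor) = ⊥-elim (no-minor (minor-≅ˡ ψ (minor-≅ʳ χ minor)))
  resolve {R} {S} ψ χ (via G i4c R≥G G≥S e) with ∧-true {∣E∣ G <ᵇ ∣E∣ R} e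
  ... | lt , le = ⊥-elim (<⇒≱ (gap G i4c (minor-≅ˡ (≅-sym ψ) R≥G , not-iso) (minor-≅ʳ (≅-sym χ) G≥S))
          (subst (_≤ ∣E∣ G + 3) (sym (Transport.∣E∣-≅ ψ)) (≤ᵇ-sound (∣E∣ R) _ le)))
    where
    -- Having fewer edges than G₁ makes the minor proper.
    not-iso : ¬ G ≅ G₁
    not-iso iso = <-irrefl (Transport.∣E∣-≅ (≅-trans iso ψ)) (<ᵇ-sound _ _ lt)
  by-size : ∀ {R S} → G₁ ≅ R → G₂ ≅ S → Verdict R → Small S → Conclusion G₁ G₂
  by-size ψ χ (v , _ , _) is-K₄ = resolve ψ χ v
  by-size ψ χ (_ , v , _) is-K₃₃ = resolve ψ χ v
  by-size ψ χ (_ , _ , v) is-K₅ = resolve ψ χ v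
  by-size {S = S} ψ χ _ (large e) = ⊥-elim (<⇒≱ gap₂ (≤-trans E≤15
    (+-monoˡ-≤ 3 (subst (12 ≤_) (sym (Transport.∣E∣-≅ χ)) (≤ᵇ-sound 12 (∣E∣ S) e)))))
  conclude : (Σ Graph λ R → R ∈ graphs × G₁ ≅ R) → (Σ Graph λ S → S ∈ graphs × G₂ ≅ S) → Conclusion G₁ G₂
  conclude (R , R∈ , ψ) (S , S∈ , χ) = by-size ψ χ (All.lookup verdicts R∈) (All.lookup smalls S∈)
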